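{- The problem of deciding, given a multi-digraph $G$, whether $G$ contains a subgraph homeomorphic to the Wheatstone graph $\mathcal W$ can be solved in time polynomial in the size of $G$.
   Context: Graphs are finite; a multi-digraph is a directed graph in which parallel edges are allowed. $\mathcal W$ is the digraph with nodes $a,b,c,d$ and edges $a\to b$, $a\to c$, $b\to c$, $b\to d$, $c\to d$. $G$ contains a subgraph homeomorphic to $\mathcal W$ if there are an injective map $\phi$ from the nodes of $\mathcal W$ to the nodes of $G$ and an injective map $\psi$ assigning to each edge $x\to y$ of $\mathcal W$ a simple directed path of $G$ from $\phi(x)$ to $\phi(y)$, such that the five paths are pairwise node-disjoint except for the endpoints they share as images of common endpoints in $\mathcal W$. The node mapping $\phi$ is not part of the input. -}

module Defs where

open import Data.Bool using (if_then_else_)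
open import Data.Fin using (Fin; toℕ; #_)
open import Data.List using (List; []; _∷_; concatMap; allFin)
open import Data.List.Membership.Propositional using (_∈_)
open import Data.List.Relation.Unary.Unique.Propositional using (Unique)
open import Data.Nat using (ℕ; zero; suc; _+_; _*_; _∸_; _^_; _≤_; _≡ᵇ_)
open import Data.Product using (Σ-syntax; ∃-syntax; _×_; _,_)
open import Data.Sum using (_⊎_)
open import Data.Vec using (Vec; []; _∷_; lookup)
open import Function.Definitions using (Injective)
open import Relation.Binary.PropositionalEquality using (_≡_; _≢_)
open import Relation.Nullary using (¬_)

------------------------------------------------------------------------
-- Multi-digraphs

-- Edges have an identity of their own, so parallel edges are allowed.
-- Self-loops are not excluded.
record MultiDigraph : Set where
  field
    #nodes #edges : ℕ
    src tgt       : Fin #edges → Fin #nodes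

  Node Edge : Set
  Node = Fin #nodes
  Edge = Fin #edges

  Endpoint : Node → Edge → Set
  Endpoint x e = x ≡ src e ⊎ x ≡ tgt e

  data Walk : Node → Node → Set where
    []  : ∀ {u} → Walk u u
    via : ∀ {u v} (e : Edge) → src e ≡ u → Walk (tgt e) v → Walk u v

  nodes : ∀ {u v} → Walk u v → List Node
  nodes {u} []          = u ∷ []
  nodes {u} (via _ _ p) = u ∷ nodes p

  Simple : ∀ {u v} → Walk u v → Set
  Simple p = Unique (nodes p)

-- "G contains a subgraph homeomorphic to H".
record HomeomorphicSubgraph (H G : MultiDigraph) : Set where
  private
    module H = MultiDigraph H
    module G = MultiDigraph G
  field
    φ           : H.Node → G.Node
    φ-injective : Injective _≡_ _≡_ φ
    ψ           : (e : H.Edge) → G.Walk (φ (H.src e)) (φ (H.tgt e))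
    ψ-simple    : ∀ e → G.Simple (ψ e)

  -- ψ as a map into the set of all walks of G, regardless of endpoints.
  ψ′ : H.Edge → ∃[ u ] ∃[ v ] G.Walk u v
  ψ′ e = φ (H.src e) , φ (H.tgt e) , ψ e

  field
    ψ-injective : Injective _≡_ _≡_ ψ′
    ψ-disjoint  : ∀ {e e′} → e ≢ e′ → ∀ {v} →
                  v ∈ G.nodes (ψ e) → v ∈ G.nodes (ψ e′) →
                  ∃[ x ] (H.Endpoint x e × H.Endpoint x e′ × v ≡ φ x)

-- a, b, c, d are 0, 1, 2, 3; the edges are ab, ac, bc, bd, cd.
Wheatstone : MultiDigraph
Wheatstone = record
  { #nodes = 4
  ; #edges = 5
  ; src    = lookup (# 0 ∷ # 0 ∷ # 1 ∷ # 1 ∷ # 2 ∷ [])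
  ; tgt    = lookup (# 1 ∷ # 2 ∷ # 2 ∷ # 3 ∷ # 3 ∷ [])
  }

------------------------------------------------------------------------
-- Random access machines

-- Structured programs for a unit-cost RAM with constants, addition and
-- truncated subtraction.  There is no multiplication: each step lengthens
-- the largest stored number by at most one bit (up to a constant depending
-- on the program), so unit cost is polynomially equivalent to Turing
-- machine time.

Reg : Set
Reg = ℕ

data Program : Set where
  skip    : Program
  set     : Reg → ℕ → Program                    -- Rᵢ ← n
  add     : Reg → Reg → Reg → Program            -- Rᵢ ← Rⱼ + Rₖ
  sub     : Reg → Reg → Reg → Program            -- Rᵢ ← Rⱼ ∸ Rₖ
  load    : Reg → Reg → Program                  -- Rᵢ ← M[Rⱼ]
  store   : Reg → Reg → Program                  -- M[Rᵢ] ← Rⱼ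
  _⨾_     : Program → Program → Program
  ifnz    : Reg → Program → Program → Program    -- branch on Rᵢ ≠ 0
  whilenz : Reg → Program → Program              -- loop while Rᵢ ≠ 0

infixr 5 _⨾_

-- Registers are addressed only directly, memory cells only through
-- registers; a program mentions finitely many registers.
record State : Set where
  constructor ⟨_,_⟩
  field
    reg : Reg → ℕ
    mem : ℕ → ℕ

_[_≔_] : (ℕ → ℕ) → ℕ → ℕ → (ℕ → ℕ)
(f [ i ≔ n ]) j = if j ≡ᵇ i then n else f j

-- p ⊢ s ⇓[ t ] s′ : started in s, the program p halts in s′ after t steps.
infix 4 _⊢_⇓[_]_

data _⊢_⇓[_]_ : Program → State → ℕ → State → Set where

  ⇓skip  : ∀ {s} → skip ⊢ s ⇓[ 1 ] s

  ⇓set   : ∀ {i n r m} →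
           set i n ⊢ ⟨ r , m ⟩ ⇓[ 1 ] ⟨ r [ i ≔ n ] , m ⟩

  ⇓add   : ∀ {i j k r m} →
           add i j k ⊢ ⟨ r , m ⟩ ⇓[ 1 ] ⟨ r [ i ≔ r j + r k ] , m ⟩

  ⇓sub   : ∀ {i j k r m} →
           sub i j k ⊢ ⟨ r , m ⟩ ⇓[ 1 ] ⟨ r [ i ≔ r j ∸ r k ] , m ⟩

  ⇓load  : ∀ {i j r m} →
           load i j ⊢ ⟨ r , m ⟩ ⇓[ 1 ] ⟨ r [ i ≔ m (r j) ] , m ⟩

  ⇓store : ∀ {i j r m} →
           store i j ⊢ ⟨ r , m ⟩ ⇓[ 1 ] ⟨ r , m [ r i ≔ r j ] ⟩

  ⇓seq   : ∀ {p q s s′ s″ t t′} →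
           p ⊢ s ⇓[ t ] s′ → q ⊢ s′ ⇓[ t′ ] s″ →
           p ⨾ q ⊢ s ⇓[ t + t′ ] s″

  ⇓then  : ∀ {i p q s s′ t} → State.reg s i ≢ 0 →
           p ⊢ s ⇓[ t ] s′ →
           ifnz i p q ⊢ s ⇓[ suc t ] s′

  ⇓else  : ∀ {i p q s s′ t} → State.reg s i ≡ 0 →
           q ⊢ s ⇓[ t ] s′ →
           ifnz i p q ⊢ s ⇓[ suc t ] s′

  ⇓loop  : ∀ {i p s s′ s″ t t′} → State.reg s i ≢ 0 →
           p ⊢ s ⇓[ t ] s′ → whilenz i p ⊢ s′ ⇓[ t′ ] s″ →
           whilenz i p ⊢ s ⇓[ suc (t + t′) ] s″

  ⇓exit  : ∀ {i p s} → State.reg s i ≡ 0 →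
           whilenz i p ⊢ s ⇓[ 1 ] s

------------------------------------------------------------------------
-- Polynomial-time decidability

-- The list as an initial memory segment, followed by zeros.
contents : List ℕ → ℕ → ℕ
contents []       _       = 0
contents (x ∷ _)  zero    = x
contents (_ ∷ xs) (suc i) = contents xs i

initial : List ℕ → State
initial xs = ⟨ (λ _ → 0) , contents xs ⟩

-- The answer is left in register 0: 1 for yes, 0 for no.
PolyTimeDecidable : {A : Set} (encode : A → List ℕ) (size : A → ℕ) →
                    (A → Set) → Set
PolyTimeDecidable {A} encode size P =
  Σ[ p ∈ Program ] ∃[ c ] ∃[ k ] ((x : A) →
    ∃[ t ] ∃[ s ] ( p ⊢ initial (encode x) ⇓[ t ] s
                  × t ≤ c * size x ^ k + c
                  × ( (State.reg s 0 ≡ 1 × P x)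
                    ⊎ (State.reg s 0 ≡ 0 × ¬ P x))))

module _ (G : MultiDigraph) where
  open MultiDigraph G

  -- Number of nodes, number of edges, then source and target of each edge.
  -- No entry exceeds the size, so the bit length of this encoding is
  -- polynomially related to the size.
  encodeGraph : List ℕ
  encodeGraph =
    #nodes ∷ #edges ∷
    concatMap (λ e → toℕ (src e) ∷ toℕ (tgt e) ∷ []) (allFin #edges)

  sizeGraph : ℕ
  sizeGraph = #nodes + #edges

{-# OPTIONS --safe #-}
module Submission where

-- Fix distinct nodes a and d.  A Wheatstone subdivision from a to d consists
-- of two internally disjoint paths P and Q from a to d through some further
-- node each, and a path from P to Q in G − {a, d}.  Which paths are chosen
-- hardly matters: given disjoint paths P from p and Q from q to
-- predecessors of d, where p and q are successors of a, it is enough that in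
-- G − {a, d} the node p also reaches the end of Q, since a path witnessing
-- this leaves P for the last time and then enters Q.  Restricting the ends
-- of P and Q to predecessors of d reachable from p, the existence of P and Q
-- becomes, by Menger's theorem, the absence of a single separating node.  So
-- the property is first-order over reachability in G minus at most three
-- nodes, and every formula of that logic is decided by nested loops in
-- polynomial time.

open import Defs
open import Data.Bool using (true; false)
open import Data.Empty using (⊥-elim)
open import Data.Fin using (Fin; zero; suc; toℕ; fromℕ<; _≟_; #_)
open import Data.Fin.Patterns
import Data.Fin.Properties as Fin
open import Data.List as List using (List; []; _∷_; _++_; [_]; length; concat; concatMap; tabulate)
open import Data.List.Properties using (++-assoc; length-++; ++-identityʳ)
open import Data.List.Membership.Propositional using (_∈_; _∉_)
open import Data.List.Membership.Propositional.Properties using (∈-++⁺ˡ; ∈-++⁺ʳ; ∈-++⁻; ∈-lookup)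
import Data.List.Membership.DecPropositional as DecMembership
open import Data.List.Relation.Binary.Disjoint.Propositional using (Disjoint)
open import Data.List.Relation.Unary.All as All using (All; []; _∷_)
import Data.List.Relation.Unary.All.Properties as All
open import Data.List.Relation.Unary.AllPairs using ([]; _∷_)
open import Data.List.Relation.Unary.Any using (here; there)
open import Data.List.Relation.Unary.Unique.Propositional using (Unique)
import Data.List.Relation.Unary.Unique.Propositional.Properties as Unique
open import Data.Nat as ℕ using (ℕ; zero; suc; _+_; _*_; _∸_; _^_; _≤_; _<_; _≡ᵇ_; z≤n; s≤s)
open import Data.Nat.Induction using (<-wellFounded)
import Data.Nat.Properties as ℕ
open import Data.Product using (Σ-syntax; ∃-syntax; _×_; _,_; proj₁; proj₂)
open import Data.Sum as Sum using (_⊎_; inj₁; inj₂; [_,_]′)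
open import Data.Sum.Properties using (inj₁-injective; inj₂-injective)
open import Data.Vec using (Vec; []; _∷_; lookup)
open import Function using (_∘_; _$_; case_of_)
open import Induction.WellFounded using (Acc; acc)
open import Relation.Binary using (DecidableEquality)
open import Relation.Binary.Construct.Closure.ReflexiveTransitive as Star using (Star; ε; _◅_; _◅◅_)
open import Relation.Binary.PropositionalEquality
  using (_≡_; _≢_; refl; sym; trans; cong; cong₂; subst)
open import Relation.Nullary using (¬_; yes; no; contradiction)
open import Relation.Nullary.Decidable using (_⊎-dec_; _→-dec_; toWitness)
open import Relation.Unary using (Decidable)

-- Paths and Menger's theorem

-- Two disjoint paths with prescribed ends in a prescribed pairing are NP-complete to find in
-- digraphs. The criterion escapes this because the ends are only asked to lie in one set, all of
-- whose members `p` reaches: whichever end falls to the path from `q`, a path from `p` to it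
-- exists, and a bridge can be cut out of that path. So Menger's theorem is needed only for two
-- paths into a set. Conversely, a single node cannot lie on both `P` and `Q` of a given
-- subdivision, so one of them always survives its removal. On the machine side no excluded middle
-- is used: every program ends with a proof of one of two alternatives, and these proofs are carried
-- through loops and negations.

Unique-++⁻ : ∀ {A : Set} (xs : List A) {ys} → Unique (xs ++ ys) →
             Unique xs × Unique ys × Disjoint xs ys
Unique-++⁻ []       u        = [] , u , λ ()
Unique-++⁻ (x ∷ xs) (x# ∷ u) with Unique-++⁻ xs u
... | uxs , uys , xs#ys = All.++⁻ˡ xs x# ∷ uxs , uys , λ where
  (here refl , v∈ys) → All.lookup (All.++⁻ʳ xs x#) v∈ys refl
  (there v∈xs , v∈ys) → xs#ys (v∈xs , v∈ys)

module Walks {V : Set} (_≟_ : DecidableEquality V) {E : V → V → Set} where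

  open DecMembership _≟_ using (_∈?_)

  private variable
    p q t u v w x : V

  -- Without the last node, joining two paths joins these lists with no repetition at the seam, and
  -- the length is the number of edges.
  origins : Star E u v → List V
  origins ε             = []
  origins {u} (_ ◅ π) = u ∷ origins π

  trail : Star E u v → List V
  trail {v = v} π = origins π ++ [ v ]

  later : Star E u v → List V
  later ε       = []
  later (_ ◅ π) = trail π

  first∈ : (π : Star E u v) → u ∈ trail π
  first∈ ε       = here refl
  first∈ (_ ◅ _) = here refl

  last∈ : (π : Star E u v) → v ∈ trail π
  last∈ π = ∈-++⁺ʳ (origins π) (here refl)

  origins⊆trail : (π : Star E u v) → x ∈ origins π → x ∈ trail π
  origins⊆trail π = ∈-++⁺ˡ

  ∈trail⁻ : (π : Star E u v) → x ∈ trail π → x ∈ origins π ⊎ x ≡ v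
  ∈trail⁻ π x∈ with ∈-++⁻ (origins π) x∈
  ... | inj₁ x∈π       = inj₁ x∈π
  ... | inj₂ (here eq) = inj₂ eq

  ∈trail-later : (π : Star E u v) → x ∈ trail π → x ≡ u ⊎ x ∈ later π
  ∈trail-later ε       (here eq)  = inj₁ eq
  ∈trail-later (_ ◅ π) (here eq)  = inj₁ eq
  ∈trail-later (_ ◅ π) (there x∈) = inj₂ x∈

  trail-later : (π : Star E u v) → trail π ≡ u ∷ later π
  trail-later ε       = refl
  trail-later (_ ◅ _) = refl

  origins-◅◅ : (π : Star E u v) (ρ : Star E v w) → origins (π ◅◅ ρ) ≡ origins π ++ origins ρ
  origins-◅◅ ε       ρ = refl
  origins-◅◅ (_ ◅ π) ρ = cong (_ ∷_) (origins-◅◅ π ρ)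

  trail-◅◅ : (π : Star E u v) (ρ : Star E v w) → trail (π ◅◅ ρ) ≡ origins π ++ trail ρ
  trail-◅◅ ε       ρ = refl
  trail-◅◅ (_ ◅ π) ρ = cong (_ ∷_) (trail-◅◅ π ρ)

  ∈trail-◅◅⁻ : (π : Star E u v) (ρ : Star E v w) →
               x ∈ trail (π ◅◅ ρ) → x ∈ origins π ⊎ x ∈ trail ρ
  ∈trail-◅◅⁻ π ρ x∈ = ∈-++⁻ (origins π) (subst (_ ∈_) (trail-◅◅ π ρ) x∈)

  ∈origins-◅◅⁻ : (π : Star E u v) (ρ : Star E v w) →
                 x ∈ origins (π ◅◅ ρ) → x ∈ origins π ⊎ x ∈ origins ρ
  ∈origins-◅◅⁻ π ρ x∈ = ∈-++⁻ (origins π) (subst (_ ∈_) (origins-◅◅ π ρ) x∈)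

  record Split (π : Star E u v) : Set where
    constructor split
    field
      {mid}  : V
      before : Star E u mid
      after  : Star E mid v
      joins  : before ◅◅ after ≡ π

    trail-joins : trail π ≡ origins before ++ trail after
    trail-joins = trans (cong trail (sym joins)) (trail-◅◅ before after)

    origins-joins : origins π ≡ origins before ++ origins after
    origins-joins = trans (cong origins (sym joins)) (origins-◅◅ before after)

    after⊆ : x ∈ trail after → x ∈ trail π
    after⊆ x∈ = subst (_ ∈_) (sym trail-joins) (∈-++⁺ʳ (origins before) x∈)

    origins-before⊆ : x ∈ origins before → x ∈ origins π
    origins-before⊆ x∈ = subst (_ ∈_) (sym origins-joins) (∈-++⁺ˡ x∈)

    before⊆ : x ∈ trail before → x ∈ trail π
    before⊆ x∈ with ∈trail⁻ before x∈
    ... | inj₁ x∈before = origins⊆trail π (origins-before⊆ x∈before)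
    ... | inj₂ refl     = after⊆ (first∈ after)

    simple⁻ : Unique (trail π) →
              Unique (origins before) × Unique (trail after) × Disjoint (origins before) (trail after)
    simple⁻ uπ = Unique-++⁻ (origins before) (subst Unique trail-joins uπ)

  open Split public

  extend : (e : E u v) {π : Star E v w} → Split π → Split (e ◅ π)
  extend e s = split (e ◅ before s) (after s) (cong (e ◅_) (joins s))

  splitAt : (π : Star E u v) → x ∈ trail π → Σ[ s ∈ Split π ] mid s ≡ x
  splitAt ε       (here refl) = split ε ε refl , refl
  splitAt (e ◅ π) (here refl) = split ε (e ◅ π) refl , refl
  splitAt (e ◅ π) (there x∈) with splitAt π x∈
  ... | s , eq = extend e s , eq

  module _ {H : V → Set} (H? : Decidable H) where

    firstHit : (π : Star E u v) → All (¬_ ∘ H) (trail π) ⊎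
               (Σ[ s ∈ Split π ] H (mid s) × All (¬_ ∘ H) (origins (before s)))
    firstHit {u} π with H? u
    ... | yes h = inj₂ (split ε π refl , h , [])
    firstHit ε       | no ¬h = inj₁ (¬h ∷ [])
    firstHit (e ◅ π) | no ¬h with firstHit π
    ... | inj₁ none         = inj₁ (¬h ∷ none)
    ... | inj₂ (s , h , ¬H) = inj₂ (extend e s , h , ¬h ∷ ¬H)

    lastHit : (π : Star E u v) → All (¬_ ∘ H) (trail π) ⊎
              (Σ[ s ∈ Split π ] H (mid s) × All (¬_ ∘ H) (later (after s)))
    lastHit {u} ε with H? u
    ... | yes h = inj₂ (split ε ε refl , h , [])
    ... | no ¬h = inj₁ (¬h ∷ [])
    lastHit {u} (e ◅ π) with lastHit π
    ... | inj₂ (s , h , ¬H) = inj₂ (extend e s , h , ¬H)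
    ... | inj₁ none with H? u
    ...   | yes h = inj₂ (split ε (e ◅ π) refl , h , none)
    ...   | no ¬h = inj₁ (¬h ∷ none)

  simplify : (π : Star E u v) →
             Σ[ ρ ∈ Star E u v ] Unique (trail ρ) × (∀ {x} → x ∈ trail ρ → x ∈ trail π)
  simplify ε = ε , [] ∷ [] , λ x∈ → x∈
  simplify {u} (e ◅ π) with simplify π
  ... | ρ , uρ , ρ⊆π with u ∈? trail ρ
  ...   | no u∉ρ = e ◅ ρ , All.¬Any⇒All¬ _ u∉ρ ∷ uρ , λ where
    (here eq)  → here eq
    (there x∈) → there (ρ⊆π x∈)
  -- If `u` recurs on `ρ`, the part of `ρ` from there on is already a simple path from `u`, and the
  -- closed detour is dropped.
  ...   | yes u∈ρ with splitAt ρ u∈ρ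
  ...     | s , refl = after s , proj₁ (proj₂ (simple⁻ s uρ)) , there ∘ ρ⊆π ∘ after⊆ s

  -- The ends need only lie in `T`, so augmentation is free to choose which start inherits the stem.
  record Linkage (T : V → Set) (p q : V) : Set where
    constructor linkage
    field
      {end₁ end₂} : V
      end₁∈T      : T end₁
      end₂∈T      : T end₂
      path₁       : Star E p end₁
      path₂       : Star E q end₂
      disjoint    : Disjoint (trail path₁) (trail path₂)

  swapLinkage : ∀ {T p q} → Linkage T p q → Linkage T q p
  swapLinkage (linkage t₁ t₂ π₁ π₂ π₁#π₂) = linkage t₂ t₁ π₂ π₁ λ (a , b) → π₁#π₂ (b , a)

  -- A partial linkage: left and right have merged at join, and continue
  -- together along stem.  Augmentation moves join towards the end of stem.
  record Fork (T : V → Set) (p q : V) : Set where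
    field
      {join end}  : V
      end∈T       : T end
      left        : Star E p join
      right       : Star E q join
      stem        : Star E join end
      left#right  : Disjoint (origins left) (origins right)
      left#stem   : Disjoint (origins left) (trail stem)
      right#stem  : Disjoint (origins right) (trail stem)
      stem-simple : Unique (trail stem)

    remaining : ℕ
    remaining = length (origins stem)

  open Fork

  swapFork : ∀ {T p q} → Fork T p q → Fork T q p
  swapFork F = record
    { end∈T = end∈T F ; left = right F ; right = left F ; stem = stem F
    ; left#right = λ (a , b) → left#right F (b , a)
    ; left#stem = right#stem F ; right#stem = left#stem F ; stem-simple = stem-simple F }

  Progress : ∀ {T p q} → Fork T p q → Set
  Progress {T} {p} {q} F = Linkage T p q ⊎ (Σ[ F′ ∈ Fork T p q ] remaining F′ < remaining F)

  swapProgress : ∀ {T p q} (F : Fork T p q) → Progress (swapFork F) → Progress F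
  swapProgress F (inj₁ L)         = inj₁ (swapLinkage L)
  swapProgress F (inj₂ (F′ , <F)) = inj₂ (swapFork F′ , <F)

  -- The new path follows `left` up to `m` and then `σ`. If `σ` misses the stem, `right` keeps the
  -- stem and a linkage results. Otherwise the paths merge at the first node of `σ` on the stem,
  -- `right` being prolonged along the stem. As `σ` avoids `join`, that node comes strictly later,
  -- and less of the stem remains.
  reroute : ∀ {T p q m t} (F : Fork T p q) → m ∈ origins (left F) → T t →
            (σ : Star E m t) → join F ∉ trail σ →
            (∀ {x} → x ∈ later σ → x ∉ origins (left F)) →
            (∀ {x} → x ∈ later σ → x ∉ origins (right F)) → Progress F
  reroute F m∈left t∈T σ join∉σ σ#left σ#right
    with splitAt (left F) (origins⊆trail (left F) m∈left) | firstHit (_∈? trail (stem F)) σ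
  ... | l , refl | inj₁ σ#stem = inj₁ (linkage t∈T (end∈T F) (before l ◅◅ σ) (right F ◅◅ stem F) disj)
    where
    disj : Disjoint _ _
    disj (a , b) with ∈trail-◅◅⁻ (before l) σ a | ∈trail-◅◅⁻ (right F) (stem F) b
    ... | inj₁ a | inj₁ b = left#right F (origins-before⊆ l a , b)
    ... | inj₁ a | inj₂ b = left#stem F (origins-before⊆ l a , b)
    ... | inj₂ a | inj₂ b = All.lookup σ#stem a b
    ... | inj₂ a | inj₁ b with ∈trail-later σ a
    ...   | inj₁ refl = left#right F (m∈left , b)
    ...   | inj₂ a    = σ#right a b
  ... | l , refl | inj₂ (s , r∈stem , s#stem) with splitAt (stem F) r∈stem
  ...   | r , refl = inj₂ (record
    { end∈T = end∈T F
    ; left  = before l ◅◅ before s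
    ; right = right F ◅◅ before r
    ; stem  = after r
    ; left#right = λ (a , b) → new# a
        (Sum.map₂ (origins⊆trail (stem F) ∘ origins-before⊆ r) (∈origins-◅◅⁻ (right F) (before r) b))
    ; left#stem = λ (a , b) → new# a (inj₂ (after⊆ r b))
    ; right#stem = λ (a , b) →
        [ (λ a → right#stem F (a , after⊆ r b))
        , (λ a → proj₂ (proj₂ (simple⁻ r (stem-simple F))) (a , b)) ]′
        (∈origins-◅◅⁻ (right F) (before r) a)
    ; stem-simple = proj₁ (proj₂ (simple⁻ r (stem-simple F)))
    } , shorter r (λ eq → join∉σ (subst (_∈ trail σ) eq (after⊆ s (first∈ (after s))))))
    where
    new# : ∀ {x} → x ∈ origins (before l ◅◅ before s) → ¬ (x ∈ origins (right F) ⊎ x ∈ trail (stem F))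
    new# a b with ∈origins-◅◅⁻ (before l) (before s) a | b
    ... | inj₁ a | inj₁ b = left#right F (origins-before⊆ l a , b)
    ... | inj₁ a | inj₂ b = left#stem F (origins-before⊆ l a , b)
    ... | inj₂ a | inj₂ b = All.lookup s#stem a b
    ... | inj₂ a | inj₁ b with ∈trail-later σ (before⊆ s (origins⊆trail (before s) a))
    ...   | inj₁ refl = left#right F (m∈left , b)
    ...   | inj₂ a    = σ#right a b

    shorter : ∀ {u v} {π : Star E u v} (r : Split π) → mid r ≢ u →
              length (origins (after r)) < length (origins π)
    shorter (split ε _ _)          ≢u = ⊥-elim (≢u refl)
    shorter (split (e ◅ b) a refl) ≢u = s≤s (subst (length (origins a) ≤_)
      (sym (trans (cong length (origins-◅◅ b a)) (length-++ (origins b)))) (ℕ.m≤n+m _ _))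

  -- `v` ranges over all nodes, starts and targets included. For `v` equal to `p` the path must
  -- start at `q`, so `p` and `q` differ.
  Unseparated : (T : V → Set) (p q : V) → Set
  Unseparated T p q = ∀ v → ∃[ s ] ∃[ t ] ((s ≡ p ⊎ s ≡ q) × T t × (Σ[ π ∈ Star E s t ] v ∉ trail π))

  origin-∈ : (π : Star E u v) → u ≢ v → u ∈ origins π
  origin-∈ ε       u≢v = ⊥-elim (u≢v refl)
  origin-∈ (_ ◅ _) _   = here refl

  -- A path avoiding `join` starts on `left` or `right` before their meeting point. After its last
  -- node on either it meets neither again, which is what `reroute` asks for; the two sides are
  -- symmetric.
  augment : ∀ {T p q} → Unseparated T p q → (F : Fork T p q) → Progress F
  augment unsep F with unsep (join F)
  ... | s , t , s∈ , t∈T , π , z∉π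
    with lastHit (λ x → x ∈? origins (left F) ⊎-dec x ∈? origins (right F)) π
  ...   | inj₁ none = ⊥-elim (All.lookup none (first∈ π) (start s∈))
    where
    z≢s : s ≢ join F
    z≢s refl = z∉π (first∈ π)
    start : s ≡ _ ⊎ s ≡ _ → _
    start (inj₁ refl) = inj₁ (origin-∈ (left F) z≢s)
    start (inj₂ refl) = inj₂ (origin-∈ (right F) z≢s)
  ...   | inj₂ (c , inj₁ m∈ , after#) =
    reroute F m∈ t∈T (after c) (z∉π ∘ after⊆ c)
      (λ x∈ → All.lookup after# x∈ ∘ inj₁) (λ x∈ → All.lookup after# x∈ ∘ inj₂)
  ...   | inj₂ (c , inj₂ m∈ , after#) = swapProgress F $
    reroute (swapFork F) m∈ t∈T (after c) (z∉π ∘ after⊆ c)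
      (λ x∈ → All.lookup after# x∈ ∘ inj₂) (λ x∈ → All.lookup after# x∈ ∘ inj₁)

  completeFork : ∀ {T p q} → Unseparated T p q → Fork T p q → Linkage T p q
  completeFork {T} {p} {q} unsep F = go F (<-wellFounded (remaining F))
    where
    go : (F : Fork T p q) → Acc _<_ (remaining F) → Linkage T p q
    go F (acc rs) with augment unsep F
    ... | inj₁ L         = L
    ... | inj₂ (F′ , <F) = go F′ (rs <F)

  -- A path that avoids `p` must come from `q`. It is followed until it first meets a simple path
  -- from `p` into `T`: if it never does, the two form a linkage, otherwise the initial fork.
  menger : ∀ {T p q} → Unseparated T p q → ∀ {t} → T t → Star E p t → Linkage T p q
  menger {T} {p} {q} unsep t∈T π with simplify π | unsep p
  ... | ρ , uρ , _ | s , t , inj₁ refl , t′∈T , σ , p∉σ = ⊥-elim (p∉σ (first∈ σ))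
  ... | ρ , uρ , _ | s , t , inj₂ refl , t′∈T , σ , p∉σ with firstHit (_∈? trail ρ) σ
  ...   | inj₁ σ#ρ = linkage t∈T t′∈T ρ σ λ (a , b) → All.lookup σ#ρ b a
  ...   | inj₂ (c , m∈ρ , c#ρ) with splitAt ρ m∈ρ
  ...     | r , refl = completeFork unsep (record
    { end∈T = t∈T ; left = before r ; right = before c ; stem = after r
    ; left#right = λ (a , b) → All.lookup c#ρ b (origins⊆trail ρ (origins-before⊆ r a))
    ; left#stem = proj₂ (proj₂ (simple⁻ r uρ))
    ; right#stem = λ (a , b) → All.lookup c#ρ a (after⊆ r b)
    ; stem-simple = proj₁ (proj₂ (simple⁻ r uρ)) })

-- Subdivisions of the Wheatstone graph

lookup⊆concat : ∀ {A : Set} {v : A} xss i → v ∈ List.lookup xss i → v ∈ concat xss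
lookup⊆concat (xs ∷ xss) zero    v∈ = ∈-++⁺ˡ v∈
lookup⊆concat (xs ∷ xss) (suc i) v∈ = ∈-++⁺ʳ xs (lookup⊆concat xss i v∈)

Unique-concat⁻ : ∀ {A : Set} (xss : List (List A)) → Unique (concat xss) →
                 ∀ i → Unique (List.lookup xss i)
Unique-concat⁻ (xs ∷ xss) u zero    = proj₁ (Unique-++⁻ xs u)
Unique-concat⁻ (xs ∷ xss) u (suc i) = Unique-concat⁻ xss (proj₁ (proj₂ (Unique-++⁻ xs u))) i

-- This reduces the disjointness demands on a subdivision to the uniqueness of a single list.
concat-separated : ∀ {A : Set} {v : A} (xss : List (List A)) → Unique (concat xss) →
                   ∀ i j → v ∈ List.lookup xss i → v ∈ List.lookup xss j → i ≡ j
concat-separated (xs ∷ xss) u zero    zero    _ _ = refl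
concat-separated (xs ∷ xss) u zero    (suc j) a b =
  ⊥-elim (proj₂ (proj₂ (Unique-++⁻ xs u)) (a , lookup⊆concat xss j b))
concat-separated (xs ∷ xss) u (suc i) zero    a b =
  ⊥-elim (proj₂ (proj₂ (Unique-++⁻ xs u)) (b , lookup⊆concat xss i a))
concat-separated (xs ∷ xss) u (suc i) (suc j) a b =
  cong suc (concat-separated xss (proj₁ (proj₂ (Unique-++⁻ xs u))) i j a b)

open MultiDigraph Wheatstone using () renaming (src to wsrc; tgt to wtgt; Endpoint to WEndpoint)

module Reachability (G : MultiDigraph) where
  open MultiDigraph G

  Adjacent : Node → Node → Set
  Adjacent u v = ∃[ e ] (src e ≡ u × tgt e ≡ v)

  -- Only the head of an edge is tested against `X`; the start of a path is tested once, in `Reach`.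
  Step : List Node → Node → Node → Set
  Step X u v = Adjacent u v × v ∉ X

  Reach : List Node → Node → Node → Set
  Reach X s t = s ∉ X × Star (Step X) s t

  open module Paths {E : Node → Node → Set} = Walks _≟_ {E} public

  -- The first `Reach` puts `x` into the target set for Menger's theorem; the disjunction says that
  -- `v` does not separate `p` and `q` from that set. For `v` equal to `p` only the second
  -- alternative can hold, which makes `q` distinct from `p` and keeps it off `a` and `d`.
  Criterion : Set
  Criterion = ∃[ a ] ∃[ d ] ∃[ p ] ∃[ q ] (¬ (a ≡ d) × Adjacent a p × Adjacent a q ×
    (∀ v → ∃[ x ] (Adjacent x d × Reach (a ∷ d ∷ []) p x ×
      (Reach (a ∷ d ∷ v ∷ []) p x ⊎ Reach (a ∷ d ∷ v ∷ []) q x))))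

  module _ {E F : Node → Node → Set} (f : ∀ {u v} → E u v → F u v) where
    origins-map : ∀ {u v} (π : Star E u v) → origins (Star.map f π) ≡ origins π
    origins-map ε       = refl
    origins-map (_ ◅ π) = cong (_ ∷_) (origins-map π)

  avoids : ∀ {X s t} → s ∉ X → (π : Star (Step X) s t) → All (_∉ X) (trail π)
  avoids s∉X ε                  = s∉X ∷ []
  avoids s∉X ((_ , v∉X) ◅ π) = s∉X ∷ avoids v∉X π

  toWalk : ∀ {u v} → Star Adjacent u v → Walk u v
  toWalk ε                      = []
  toWalk ((e , eq , refl) ◅ π) = via e eq (toWalk π)

  nodes-toWalk : ∀ {u v} (π : Star Adjacent u v) → nodes (toWalk π) ≡ trail π
  nodes-toWalk ε                      = refl
  nodes-toWalk ((_ , _ , refl) ◅ π) = cong (_ ∷_) (nodes-toWalk π)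

  fromWalk : ∀ {u v} → Walk u v → Star Adjacent u v
  fromWalk []           = ε
  fromWalk (via e eq π) = (e , eq , refl) ◅ fromWalk π

  nodes-fromWalk : ∀ {u v} (π : Walk u v) → trail (fromWalk π) ≡ nodes π
  nodes-fromWalk []          = refl
  nodes-fromWalk (via _ _ π) = cong (_ ∷_) (nodes-fromWalk π)

  -- `xss` cuts the nodes of the subdivision into pieces: `τ` points to the piece of each branch
  -- node, `ι` to the interior of each arc. Different pointers give disjoint pieces, from which
  -- injectivity of `φ`, simplicity and disjointness all follow.
  module Assemble
    (φ : Fin 4 → Node) (ψ : ∀ e → Star Adjacent (φ (wsrc e)) (φ (wtgt e)))
    (xss : List (List Node)) (unique : Unique (concat xss))
    (τ : Fin 4 → Fin (length xss)) (ι : Fin 5 → Fin (length xss))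
    (index-injective : ∀ {k l} → [ τ , ι ]′ k ≡ [ τ , ι ]′ l → k ≡ l)
    (φ∈ : ∀ x → φ x ∈ List.lookup xss (τ x))
    (trail-ψ : ∀ e → trail (ψ e) ≡ φ (wsrc e) ∷ List.lookup xss (ι e) ++ [ φ (wtgt e) ])
    where

    separated : ∀ {v} k l → v ∈ List.lookup xss ([ τ , ι ]′ k) →
                v ∈ List.lookup xss ([ τ , ι ]′ l) → k ≡ l
    separated k l a b = index-injective (concat-separated xss unique _ _ a b)

    φ-inj : ∀ {x y} → φ x ≡ φ y → x ≡ y
    φ-inj {x} {y} eq = inj₁-injective (separated (inj₁ x) (inj₁ y) (φ∈ x) (subst (_∈ _) (sym eq) (φ∈ y)))

    Locus : Node → Fin 5 → Set
    Locus v e = (∃[ x ] (WEndpoint x e × v ≡ φ x)) ⊎ v ∈ List.lookup xss (ι e)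

    locate : ∀ {v} e → v ∈ trail (ψ e) → Locus v e
    locate e v∈ with subst (_ ∈_) (trail-ψ e) v∈
    ... | here eq = inj₁ (_ , inj₁ refl , eq)
    ... | there v∈′ with ∈-++⁻ (List.lookup xss (ι e)) v∈′
    ...   | inj₁ i         = inj₂ i
    ...   | inj₂ (here eq) = inj₁ (_ , inj₂ refl , eq)

    disjoint′ : ∀ {e e′} → e ≢ e′ → ∀ {v} → Locus v e → Locus v e′ →
               ∃[ x ] (WEndpoint x e × WEndpoint x e′ × v ≡ φ x)
    disjoint′ {e′ = e′} e≢e′ (inj₁ (x , x∈e , refl)) (inj₁ (y , y∈e′ , eq)) =
      x , x∈e , subst (λ z → WEndpoint z e′) (sym (φ-inj eq)) y∈e′ , refl
    disjoint′ e≢e′ (inj₁ (x , _ , refl)) (inj₂ v∈) with () ← separated (inj₁ x) (inj₂ _) (φ∈ x) v∈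
    disjoint′ e≢e′ (inj₂ v∈) (inj₁ (x , _ , refl)) with () ← separated (inj₁ x) (inj₂ _) (φ∈ x) v∈
    disjoint′ e≢e′ (inj₂ v∈) (inj₂ v∈′) =
      ⊥-elim (e≢e′ (inj₂-injective (separated (inj₂ _) (inj₂ _) v∈ v∈′)))

    φ∉ : ∀ x e → φ x ∉ List.lookup xss (ι e)
    φ∉ x e φx∈ with () ← separated (inj₁ x) (inj₂ e) (φ∈ x) φx∈

    src≢tgt : ∀ e → wsrc e ≢ wtgt e
    src≢tgt 0F ()
    src≢tgt 1F ()
    src≢tgt 2F ()
    src≢tgt 3F ()
    src≢tgt 4F ()

    -- The Wheatstone graph has no parallel edges, so `ψ-injective` follows from the endpoints of
    -- the paths alone.
    ends-determine : ∀ e e′ → wsrc e ≡ wsrc e′ → wtgt e ≡ wtgt e′ → e ≡ e′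
    ends-determine = toWitness {a? = Fin.all? λ e → Fin.all? λ e′ →
      wsrc e ≟ wsrc e′ →-dec wtgt e ≟ wtgt e′ →-dec e ≟ e′} _

    subdivision : HomeomorphicSubgraph Wheatstone G
    subdivision = record
      { φ = φ
      ; φ-injective = φ-inj
      ; ψ = toWalk ∘ ψ
      ; ψ-simple = λ e → subst Unique (sym (trans (nodes-toWalk (ψ e)) (trail-ψ e))) $
          All.tabulate (λ { {x} x∈ refl → head∉ e x∈ }) ∷
          Unique.++⁺ (Unique-concat⁻ xss unique (ι e)) ([] ∷ []) (λ { (v∈ , here refl) → φ∉ _ e v∈ })
      ; ψ-injective = λ {e} {e′} eq →
          ends-determine e e′ (φ-inj (cong proj₁ eq)) (φ-inj (cong (proj₁ ∘ proj₂) eq))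
      ; ψ-disjoint = λ {e} {e′} e≢e′ v∈ v∈′ → disjoint′ e≢e′
          (locate e (subst (_ ∈_) (nodes-toWalk (ψ e)) v∈))
          (locate e′ (subst (_ ∈_) (nodes-toWalk (ψ e′)) v∈′))
      }
      where
      head∉ : ∀ e → φ (wsrc e) ∉ List.lookup xss (ι e) ++ [ φ (wtgt e) ]
      head∉ e ∈ with ∈-++⁻ (List.lookup xss (ι e)) ∈
      ... | inj₁ ∈I        = φ∉ _ e ∈I
      ... | inj₂ (here eq) = src≢tgt e (φ-inj eq)

  -- From two disjoint paths and a bridge to a subdivision

  module _ {E : Node → Node → Set} where

    open DecMembership (_≟_ {n = #nodes}) using (_∈?_)

    record Bridge {p q z₁ z₂} (P : Star E p z₁) (Q : Star E q z₂) : Set where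
      field
        onP          : Split P
        onQ          : Split Q
        bridge       : Star E (mid onP) (mid onQ)
        bridge-simple : Unique (trail bridge)
        meetsP       : ∀ {x} → x ∈ trail bridge → x ∈ trail P → x ≡ mid onP
        meetsQ       : ∀ {x} → x ∈ trail bridge → x ∈ trail Q → x ≡ mid onQ

    findBridge : ∀ {p q z₁ z₂} (P : Star E p z₁) (Q : Star E q z₂) →
                 Disjoint (trail P) (trail Q) → Star E p z₂ → Bridge P Q
    findBridge P Q P#Q R with simplify R
    ... | R₀ , R₀! , _ with lastHit (_∈? trail P) R₀
    ...   | inj₁ none = ⊥-elim (All.lookup none (first∈ R₀) (first∈ P))
    ...   | inj₂ (s , s∈P , s#P) with firstHit (_∈? trail Q) (after s)
    ...     | inj₁ none = ⊥-elim (All.lookup none (last∈ (after s)) (last∈ Q))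
    ...     | inj₂ (r , r∈Q , r#Q) with splitAt P s∈P | splitAt Q r∈Q
    ...       | sP , refl | sQ , refl = record
      { onP = sP ; onQ = sQ ; bridge = before r
      ; bridge-simple = simple-before
      ; meetsP = λ x∈ x∈P → [ (λ eq → eq) , (λ x∈′ → ⊥-elim (All.lookup s#P x∈′ x∈P)) ]′
                              (∈trail-later (after s) (before⊆ r x∈))
      ; meetsQ = λ x∈ x∈Q → [ (λ x∈′ → ⊥-elim (All.lookup r#Q x∈′ x∈Q)) , (λ eq → eq) ]′
                              (∈trail⁻ (before r) x∈) }
      where
      after! = proj₁ (proj₂ (simple⁻ s R₀!))
      simple-before : Unique (trail (before r))
      simple-before with simple⁻ r after!
      ... | b! , _ , b#a = Unique.++⁺ b! ([] ∷ []) λ { (v∈ , here refl) → b#a (v∈ , first∈ (after r)) }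

  module _ {X : List Node} {a d p q z₁ z₂} (a∈X : a ∈ X) (d∈X : d ∈ X) (a≢d : a ≢ d)
    (a→p : Adjacent a p) (a→q : Adjacent a q) (z₁→d : Adjacent z₁ d) (z₂→d : Adjacent z₂ d)
    (p∉X : p ∉ X) (q∉X : q ∉ X) (P : Star (Step X) p z₁) (Q : Star (Step X) q z₂)
    (P! : Unique (trail P)) (Q! : Unique (trail Q)) (P#Q : Disjoint (trail P) (trail Q))
    where

    subdivide : Bridge P Q → HomeomorphicSubgraph Wheatstone G
    -- An empty bridge would be a common node of `P` and `Q`.
    subdivide record { onP = sp@(split P₁ P₂ refl) ; onQ = sq@(split Q₁ Q₂ refl) ; bridge = ε } =
      ⊥-elim (P#Q (after⊆ sp (first∈ P₂) , after⊆ sq (first∈ Q₂)))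
    subdivide record { onP = sp@(split {b} P₁ P₂ refl) ; onQ = sq@(split {c} Q₁ Q₂ refl)
                     ; bridge = β₀@(_ ◅ β) ; bridge-simple = b∉β ∷ tail!
                     ; meetsP = mP ; meetsQ = mQ } =
      Assemble.subdivision φ ψ segments unique τ ι
        (λ {k} {l} eq → trans (sym (owner-at k)) (trans (cong owner eq) (owner-at l)))
        (λ { 0F → here refl ; 1F → here refl ; 2F → here refl ; 3F → here refl }) trail-ψ
      where
      free : ∀ {u v} → Star (Step X) u v → Star Adjacent u v
      free = Star.map proj₁

      φ : Fin 4 → Node
      φ = lookup (a ∷ b ∷ c ∷ d ∷ [])

      ψ : ∀ e → Star Adjacent (φ (wsrc e)) (φ (wtgt e))
      ψ 0F = a→p ◅ free P₁
      ψ 1F = a→q ◅ free Q₁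
      ψ 2F = free β₀
      ψ 3F = free P₂ ◅◅ z₁→d ◅ ε
      ψ 4F = free Q₂ ◅◅ z₂→d ◅ ε

      -- The order makes the concatenation consist of `a`, `d`, the trail of the first path, that of
      -- the second, and the inner nodes of the bridge.
      segments : List (List Node)
      segments = [ a ] ∷ [ d ] ∷ origins P₁ ∷ [ b ] ∷ later P₂ ∷
                 origins Q₁ ∷ [ c ] ∷ later Q₂ ∷ origins β ∷ []

      τ : Fin 4 → Fin 9
      τ = lookup (# 0 ∷ # 3 ∷ # 6 ∷ # 1 ∷ [])

      ι : Fin 5 → Fin 9
      ι = lookup (# 2 ∷ # 5 ∷ # 8 ∷ # 4 ∷ # 7 ∷ [])

      -- A left inverse of the index map, so that injectivity is checked by evaluation.
      owner : Fin 9 → Fin 4 ⊎ Fin 5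
      owner = lookup (inj₁ 0F ∷ inj₁ 3F ∷ inj₂ 0F ∷ inj₁ 1F ∷ inj₂ 3F ∷
                      inj₂ 1F ∷ inj₁ 2F ∷ inj₂ 4F ∷ inj₂ 2F ∷ [])

      owner-at : ∀ k → owner ([ τ , ι ]′ k) ≡ k
      owner-at = Sum.[ (λ { 0F → refl ; 1F → refl ; 2F → refl ; 3F → refl })
                     , (λ { 0F → refl ; 1F → refl ; 2F → refl ; 3F → refl ; 4F → refl }) ]

      trail-snoc : ∀ {u v w} (π : Star (Step X) u v) (v→w : Adjacent v w) →
                   trail (free π ◅◅ v→w ◅ ε) ≡ u ∷ later π ++ [ w ]
      trail-snoc {v = v} {w} π v→w =
        trans (trail-◅◅ (free π) _) (trans (cong (_++ v ∷ w ∷ []) (origins-map proj₁ π))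
        (trans (sym (++-assoc (origins π) [ v ] [ w ])) (cong (_++ [ w ]) (trail-later π))))

      trail-ψ : ∀ e → _
      trail-ψ 0F = cong (λ o → a ∷ o ++ [ b ]) (origins-map proj₁ P₁)
      trail-ψ 1F = cong (λ o → a ∷ o ++ [ c ]) (origins-map proj₁ Q₁)
      trail-ψ 2F = cong (λ o → b ∷ o ++ [ c ]) (origins-map proj₁ β)
      trail-ψ 3F = trail-snoc P₂ z₁→d
      trail-ψ 4F = trail-snoc Q₂ z₂→d

      Qβ PQβ : List Node
      Qβ  = trail (Q₁ ◅◅ Q₂) ++ origins β
      PQβ = trail (P₁ ◅◅ P₂) ++ Qβ

      β∈ : ∀ {x} → x ∈ origins β → x ∈ trail β₀
      β∈ = there ∘ origins⊆trail β

      Qβ! : Unique Qβ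
      Qβ! = Unique.++⁺ Q! (proj₁ (Unique-++⁻ (origins β) tail!))
        λ (x∈Q , x∈β) → proj₂ (proj₂ (Unique-++⁻ (origins β) tail!)) (x∈β , here (mQ (β∈ x∈β) x∈Q))

      PQβ! : Unique PQβ
      PQβ! = Unique.++⁺ P! Qβ! λ (x∈P , x∈) →
        [ (λ x∈Q → P#Q (x∈P , x∈Q))
        , (λ x∈β → All.lookup b∉β (origins⊆trail β x∈β) (sym (mP (β∈ x∈β) x∈P))) ]′
        (∈-++⁻ (trail (Q₁ ◅◅ Q₂)) x∈)

      ∉X : ∀ {x} → x ∈ PQβ → x ∉ X
      ∉X x∈ with ∈-++⁻ (trail (P₁ ◅◅ P₂)) x∈
      ... | inj₁ x∈P = All.lookup (avoids p∉X (P₁ ◅◅ P₂)) x∈P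
      ... | inj₂ x∈ with ∈-++⁻ (trail (Q₁ ◅◅ Q₂)) x∈
      ...   | inj₁ x∈Q = All.lookup (avoids q∉X (Q₁ ◅◅ Q₂)) x∈Q
      ...   | inj₂ x∈β = All.lookup (avoids b∉X β₀) (β∈ x∈β)
        where
        b∉X : b ∉ X
        b∉X = All.lookup (avoids p∉X (P₁ ◅◅ P₂)) (after⊆ sp (first∈ P₂))

      rejoin : ∀ {u v w} (π : Star (Step X) u v) (ρ : Star (Step X) v w) xs →
               origins π ++ v ∷ later ρ ++ xs ≡ trail (π ◅◅ ρ) ++ xs
      rejoin {v = v} π ρ xs = trans (sym (++-assoc (origins π) (v ∷ later ρ) xs))
        (cong (_++ xs) (sym (trans (trail-◅◅ π ρ) (cong (origins π ++_) (trail-later ρ)))))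

      arrange : concat segments ≡ a ∷ d ∷ PQβ
      arrange = cong (λ l → a ∷ d ∷ l) (trans
        (cong (λ l → origins P₁ ++ b ∷ later P₂ ++ l)
          (trans (cong (λ l → origins Q₁ ++ c ∷ later Q₂ ++ l) (++-identityʳ (origins β)))
                 (rejoin Q₁ Q₂ _)))
        (rejoin P₁ P₂ _))

      unique : Unique (concat segments)
      unique = subst Unique (sym arrange)
        ( (a≢d ∷ All.tabulate λ { x∈ refl → ∉X x∈ a∈X })
        ∷ (All.tabulate λ { x∈ refl → ∉X x∈ d∈X })
        ∷ PQβ! )

  simpleLinkage : ∀ {E T p q} → Linkage {E} T p q → Σ[ L ∈ Linkage {E} T p q ]
                  Unique (trail (Linkage.path₁ L)) × Unique (trail (Linkage.path₂ L))
  simpleLinkage (linkage t₁ t₂ P Q P#Q) with simplify P | simplify Q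
  ... | P₀ , P! , P₀⊆P | Q₀ , Q! , Q₀⊆Q =
    linkage t₁ t₂ P₀ Q₀ (λ (x∈P , x∈Q) → P#Q (P₀⊆P x∈P , Q₀⊆Q x∈Q)) , P! , Q!

  relax : ∀ {X Y s t} → (∀ {x} → x ∈ X → x ∈ Y) → Star (Step Y) s t → Star (Step X) s t
  relax X⊆Y = Star.map λ (u→v , v∉Y) → u→v , v∉Y ∘ X⊆Y

  trail-relax : ∀ {X Y s t} (X⊆Y : ∀ {x} → x ∈ X → x ∈ Y) (π : Star (Step Y) s t) →
                trail (relax X⊆Y π) ≡ trail π
  trail-relax X⊆Y π = cong (_++ [ _ ]) (origins-map (λ (u→v , v∉Y) → u→v , v∉Y ∘ X⊆Y) π)

  criterion⇒subdivision : Criterion → HomeomorphicSubgraph Wheatstone G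
  -- The instance at `p` supplies a first path from `p` into the target set. As `p` cannot avoid
  -- itself, it also shows that `q` avoids `a` and `d`.
  criterion⇒subdivision (a , d , p , q , a≢d , a→p , a→q , cut) with cut p
  ... | x₀ , x₀→d , (p∉X , p⇝x₀) , spared =
    build (simpleLinkage (menger unseparated (x₀→d , p⇝x₀) p⇝x₀))
    where
    X = a ∷ d ∷ []

    X⊆ : ∀ {v x} → x ∈ X → x ∈ a ∷ d ∷ v ∷ []
    X⊆ = ∈-++⁺ˡ

    -- Both ends of the linkage lie in `T`, so `p` also reaches the end of the path from `q`; the
    -- bridge is cut out of that path `R`.
    T : Node → Set
    T t = Adjacent t d × Star (Step X) p t

    unseparated : Unseparated T p q
    unseparated v with cut v
    ... | x , x→d , (_ , p⇝x) , r =
      [ (λ (s∉ , π) → p , x , inj₁ refl , (x→d , p⇝x) , relax X⊆ π , missed s∉ π)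
      , (λ (s∉ , π) → q , x , inj₂ refl , (x→d , p⇝x) , relax X⊆ π , missed s∉ π) ]′ r
      where
      missed : ∀ {s t} → s ∉ a ∷ d ∷ v ∷ [] → (π : Star (Step (a ∷ d ∷ v ∷ [])) s t) →
               v ∉ trail (relax X⊆ π)
      missed s∉ π v∈ =
        All.lookup (avoids s∉ π) (subst (v ∈_) (trail-relax X⊆ π) v∈) (there (there (here refl)))

    q∉X : q ∉ X
    q∉X = [ (λ (p∉ , _) → ⊥-elim (p∉ (there (there (here refl))))) , (λ (q∉ , _) → q∉ ∘ X⊆) ]′ spared

    build : (Σ[ L ∈ Linkage T p q ] _) → HomeomorphicSubgraph Wheatstone G
    build (linkage (z₁→d , _) (z₂→d , R) P Q P#Q , P! , Q!) =
      subdivide (here refl) (there (here refl)) a≢d a→p a→q z₁→d z₂→d p∉X q∉X P Q P! Q! P#Q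
        (findBridge P Q P#Q R)

  -- From a subdivision to the criterion

  uncons : ∀ {E : Node → Node → Set} {u v} → u ≢ v → (π : Star E u v) →
           ∃[ w ] (E u w × (Σ[ ρ ∈ Star E w v ] trail π ≡ u ∷ trail ρ))
  uncons u≢v ε       = ⊥-elim (u≢v refl)
  uncons u≢v (e ◅ π) = _ , e , π , refl

  unsnoc : ∀ {E : Node → Node → Set} {u v} → u ≢ v → (π : Star E u v) →
           ∃[ w ] (E w v × (Σ[ ρ ∈ Star E u w ] trail π ≡ trail ρ ++ [ v ]))
  unsnoc u≢v ε           = ⊥-elim (u≢v refl)
  unsnoc u≢v (e ◅ ε)     = _ , e , ε , refl
  unsnoc u≢v (e ◅ f ◅ π) with go e (f ◅ π)
    where
    go : ∀ {E : Node → Node → Set} {u v w} → E u v → (π : Star E v w) →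
         ∃[ x ] (E x w × (Σ[ ρ ∈ Star E u x ] u ∷ trail π ≡ trail ρ ++ [ w ]))
    go e ε       = _ , e , ε , refl
    go e (f ◅ π) with go f π
    ... | x , g , ρ , eq = x , g , e ◅ ρ , cong (_ ∷_) eq
  ... | x , g , ρ , eq = x , g , ρ , eq

  restrict : ∀ {X u v} (π : Star Adjacent u v) → (∀ {x} → x ∈ trail π → x ∉ X) → Star (Step X) u v
  restrict ε       _  = ε
  restrict (e ◅ π) ∉X = (e , ∉X (there (first∈ π))) ◅ restrict π (∉X ∘ there)

  reach : ∀ {X u v} (π : Star Adjacent u v) → (∀ {x} → x ∈ trail π → x ∉ X) → Reach X u v
  reach π ∉X = ∉X (first∈ π) , restrict π ∉X

  module _ (S : HomeomorphicSubgraph Wheatstone G) where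
    open HomeomorphicSubgraph S
    open DecMembership (_≟_ {n = #nodes}) using (_∈?_)

    arc : ∀ e → Star Adjacent (φ (wsrc e)) (φ (wtgt e))
    arc e = fromWalk (ψ e)

    arc-simple : ∀ e → Unique (trail (arc e))
    arc-simple e = subst Unique (sym (nodes-fromWalk (ψ e))) (ψ-simple e)

    arc-disjoint : ∀ {e e′} → e ≢ e′ → ∀ {v} → v ∈ trail (arc e) → v ∈ trail (arc e′) →
                   ∃[ x ] (WEndpoint x e × WEndpoint x e′ × v ≡ φ x)
    arc-disjoint {e} {e′} e≢e′ v∈ v∈′ = ψ-disjoint e≢e′
      (subst (_ ∈_) (nodes-fromWalk (ψ e)) v∈) (subst (_ ∈_) (nodes-fromWalk (ψ e′)) v∈′)

    φ∈arc⁺ : ∀ {x} e → WEndpoint x e → φ x ∈ trail (arc e)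
    φ∈arc⁺ e (inj₁ refl) = first∈ (arc e)
    φ∈arc⁺ e (inj₂ refl) = last∈ (arc e)

    -- Every branch node ends some arc `e′`. If `e′` is not `e`, disjointness yields a common
    -- endpoint with the same image, and `φ` is injective.
    φ∈arc⁻ : ∀ {x} e → φ x ∈ trail (arc e) → WEndpoint x e
    φ∈arc⁻ {x} e φx∈ with incident x
      where
      incident : ∀ x → ∃[ e ] WEndpoint x e
      incident 0F = 0F , inj₁ refl
      incident 1F = 0F , inj₂ refl
      incident 2F = 1F , inj₂ refl
      incident 3F = 3F , inj₂ refl
    ... | e′ , x∈e′ with e ≟ e′
    ...   | yes refl = x∈e′
    ...   | no e≢e′ with arc-disjoint e≢e′ φx∈ (φ∈arc⁺ e′ x∈e′)
    ...     | y , y∈e , _ , φx≡φy = subst (λ z → WEndpoint z e) (sym (φ-injective φx≡φy)) y∈e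

    -- `p` and `q` come right after the image of a on the arcs ab and ac; `x` and `y` right before
    -- that of d on bd and cd. If `v` is off `P`, then `P` is the path required. Otherwise `v` is
    -- off `Q` and `y` serves, which `p` reaches by `R` across the arc bc.
    subdivision⇒criterion : Criterion
    subdivision⇒criterion
      with uncons (λ eq → case φ-injective eq of λ ()) (arc 0F)
         | uncons (λ eq → case φ-injective eq of λ ()) (arc 1F)
         | unsnoc (λ eq → case φ-injective eq of λ ()) (arc 3F)
         | unsnoc (λ eq → case φ-injective eq of λ ()) (arc 4F)
    ... | p , a→p , P₁ , P₁≡ | q , a→q , Q₁ , Q₁≡ | x , x→d , P₂ , P₂≡ | y , y→d , Q₂ , Q₂≡ =
      a , d , p , q , (λ eq → case φ-injective eq of λ ()) , a→p , a→q , cut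
      where
      a = φ 0F
      d = φ 3F

      member₁ : ∀ {e u w} (ρ : Star Adjacent u w) → trail (arc e) ≡ φ (wsrc e) ∷ trail ρ →
                ∀ {v} → v ∈ trail ρ → v ∈ trail (arc e) × v ≢ φ (wsrc e)
      member₁ {e} ρ eq v∈ = subst (_ ∈_) (sym eq) (there v∈) ,
        λ { refl → case subst Unique eq (arc-simple e) of λ { (≢s ∷ _) → All.lookup ≢s v∈ refl } }

      member₂ : ∀ {e u w} (ρ : Star Adjacent u w) → trail (arc e) ≡ trail ρ ++ [ φ (wtgt e) ] →
                ∀ {v} → v ∈ trail ρ → v ∈ trail (arc e) × v ≢ φ (wtgt e)
      member₂ {e} ρ eq v∈ = subst (_ ∈_) (sym eq) (∈-++⁺ˡ v∈) ,
        λ { refl → case Unique-++⁻ (trail ρ) (subst Unique eq (arc-simple e)) of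
              λ (_ , _ , ρ#tgt) → ρ#tgt (v∈ , here refl) }

      off : ∀ {v} x e → v ∈ trail (arc e) → ¬ WEndpoint x e → v ≢ φ x
      off x e v∈ x∉e refl = x∉e (φ∈arc⁻ e v∈)

      inP₁ : ∀ {v} → v ∈ trail P₁ → v ∈ trail (arc 0F) × v ≢ a
      inP₁ = member₁ P₁ P₁≡
      inQ₁ : ∀ {v} → v ∈ trail Q₁ → v ∈ trail (arc 1F) × v ≢ a
      inQ₁ = member₁ Q₁ Q₁≡
      inP₂ : ∀ {v} → v ∈ trail P₂ → v ∈ trail (arc 3F) × v ≢ d
      inP₂ = member₂ P₂ P₂≡
      inQ₂ : ∀ {v} → v ∈ trail Q₂ → v ∈ trail (arc 4F) × v ≢ d
      inQ₂ = member₂ Q₂ Q₂≡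

      Inner : Node → Set
      Inner v = v ≢ a × v ≢ d

      innerP₁ : ∀ {v} → v ∈ trail P₁ → Inner v
      innerP₁ v∈ = proj₂ (inP₁ v∈) , off 3F 0F (proj₁ (inP₁ v∈)) λ { (inj₁ ()) ; (inj₂ ()) }
      innerQ₁ : ∀ {v} → v ∈ trail Q₁ → Inner v
      innerQ₁ v∈ = proj₂ (inQ₁ v∈) , off 3F 1F (proj₁ (inQ₁ v∈)) λ { (inj₁ ()) ; (inj₂ ()) }
      innerP₂ : ∀ {v} → v ∈ trail P₂ → Inner v
      innerP₂ v∈ = off 0F 3F (proj₁ (inP₂ v∈)) (λ { (inj₁ ()) ; (inj₂ ()) }) , proj₂ (inP₂ v∈)
      innerQ₂ : ∀ {v} → v ∈ trail Q₂ → Inner v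
      innerQ₂ v∈ = off 0F 4F (proj₁ (inQ₂ v∈)) (λ { (inj₁ ()) ; (inj₂ ()) }) , proj₂ (inQ₂ v∈)
      innerB : ∀ {v} → v ∈ trail (arc 2F) → Inner v
      innerB v∈ = off 0F 2F v∈ (λ { (inj₁ ()) ; (inj₂ ()) }) , off 3F 2F v∈ λ { (inj₁ ()) ; (inj₂ ()) }

      P = P₁ ◅◅ P₂
      Q = Q₁ ◅◅ Q₂
      R = P₁ ◅◅ arc 2F ◅◅ Q₂

      ∈P⁻ : ∀ {v} → v ∈ trail P → v ∈ trail P₁ ⊎ v ∈ trail P₂
      ∈P⁻ v∈ = Sum.map₁ (origins⊆trail P₁) (∈trail-◅◅⁻ P₁ P₂ v∈)
      ∈Q⁻ : ∀ {v} → v ∈ trail Q → v ∈ trail Q₁ ⊎ v ∈ trail Q₂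
      ∈Q⁻ v∈ = Sum.map₁ (origins⊆trail Q₁) (∈trail-◅◅⁻ Q₁ Q₂ v∈)

      innerP : ∀ {v} → v ∈ trail P → Inner v
      innerP v∈ = [ innerP₁ , innerP₂ ]′ (∈P⁻ v∈)
      innerQ : ∀ {v} → v ∈ trail Q → Inner v
      innerQ v∈ = [ innerQ₁ , innerQ₂ ]′ (∈Q⁻ v∈)
      innerR : ∀ {v} → v ∈ trail R → Inner v
      innerR v∈ with ∈trail-◅◅⁻ P₁ (arc 2F ◅◅ Q₂) v∈
      ... | inj₁ v∈P₁ = innerP₁ (origins⊆trail P₁ v∈P₁)
      ... | inj₂ v∈′ with ∈trail-◅◅⁻ (arc 2F) Q₂ v∈′
      ...   | inj₁ v∈B  = innerB (origins⊆trail (arc 2F) v∈B)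
      ...   | inj₂ v∈Q₂ = innerQ₂ v∈Q₂

      -- The arcs ab and ac share only the image of a, and bd and cd only that of d; these ends have
      -- been cut off. The mixed pairs of arcs have no common end.
      P#Q : Disjoint (trail P) (trail Q)
      P#Q (v∈P , v∈Q) with ∈P⁻ v∈P | ∈Q⁻ v∈Q
      ... | inj₁ i | inj₁ j with arc-disjoint (λ ()) (proj₁ (inP₁ i)) (proj₁ (inQ₁ j))
      ...   | _ , inj₁ refl , _ , refl = proj₂ (inP₁ i) refl
      ...   | _ , inj₂ refl , inj₁ () , _
      ...   | _ , inj₂ refl , inj₂ () , _
      P#Q (v∈P , v∈Q) | inj₁ i | inj₂ j with arc-disjoint (λ ()) (proj₁ (inP₁ i)) (proj₁ (inQ₂ j))
      ...   | _ , inj₁ refl , inj₁ () , _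
      ...   | _ , inj₁ refl , inj₂ () , _
      ...   | _ , inj₂ refl , inj₁ () , _
      ...   | _ , inj₂ refl , inj₂ () , _
      P#Q (v∈P , v∈Q) | inj₂ i | inj₁ j with arc-disjoint (λ ()) (proj₁ (inP₂ i)) (proj₁ (inQ₁ j))
      ...   | _ , inj₁ refl , inj₁ () , _
      ...   | _ , inj₁ refl , inj₂ () , _
      ...   | _ , inj₂ refl , inj₁ () , _
      ...   | _ , inj₂ refl , inj₂ () , _
      P#Q (v∈P , v∈Q) | inj₂ i | inj₂ j with arc-disjoint (λ ()) (proj₁ (inP₂ i)) (proj₁ (inQ₂ j))
      ...   | _ , inj₂ refl , _ , refl = proj₂ (inP₂ i) refl
      ...   | _ , inj₁ refl , inj₁ () , _
      ...   | _ , inj₁ refl , inj₂ () , _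

      inner∉ : ∀ {v} → Inner v → v ∉ a ∷ d ∷ []
      inner∉ (≢a , _)  (here eq)         = ≢a eq
      inner∉ (_  , ≢d) (there (here eq)) = ≢d eq

      inner∉′ : ∀ {v w} → Inner v → v ≢ w → v ∉ a ∷ d ∷ w ∷ []
      inner∉′ (≢a , _)  _  (here eq)                 = ≢a eq
      inner∉′ (_  , ≢d) _  (there (here eq))         = ≢d eq
      inner∉′ _         ≢w (there (there (here eq))) = ≢w eq

      cut : ∀ v → ∃[ x ] _
      cut v with v ∈? trail P
      ... | no  v∉P = x , x→d , reach P (inner∉ ∘ innerP) ,
                      inj₁ (reach P λ u∈ → inner∉′ (innerP u∈) λ { refl → v∉P u∈ })
      ... | yes v∈P = y , y→d , reach R (inner∉ ∘ innerR) ,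
                      inj₂ (reach Q λ u∈ → inner∉′ (innerQ u∈) λ { refl → P#Q (v∈P , u∈) })

-- Running programs

open State

≔-same : ∀ f i n → (f [ i ≔ n ]) i ≡ n
≔-same f i n with i ≡ᵇ i in eq
... | true  = refl
... | false = ⊥-elim (subst Data.Bool.T eq (ℕ.≡⇒≡ᵇ i i refl))

≔-other : ∀ f {i j} n → j ≢ i → (f [ i ≔ n ]) j ≡ f j
≔-other f {i} {j} n j≢i with j ≡ᵇ i in eq
... | false = refl
... | true  = ⊥-elim (j≢i (ℕ.≡ᵇ⇒≡ j i (subst Data.Bool.T (sym eq) _)))

-- A total-correctness triple at one state. The time is only bounded from above, so that both
-- branches of a conditional fit one bound.
record Runs (p : Program) (s : State) (T : ℕ) (Q : State → Set) : Set where
  constructor halts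
  field
    {time}  : ℕ
    {final} : State
    run     : p ⊢ s ⇓[ time ] final
    time≤   : time ≤ T
    post    : Q final

private variable
  p q    : Program
  s s′   : State
  T U    : ℕ
  P Q    : State → Set

stop : p ⊢ s ⇓[ 1 ] s′ → Q s′ → Runs p s 1 Q
stop run post = halts run ℕ.≤-refl post

step : p ⊢ s ⇓[ 1 ] s′ → Runs q s′ T Q → Runs (p ⨾ q) s (suc T) Q
step run (halts run′ ≤T post) = halts (⇓seq run run′) (s≤s ≤T) post

chain : Runs p s T P → (∀ {s′} → P s′ → Runs q s′ U Q) → Runs (p ⨾ q) s (T + U) Q
chain (halts run ≤T post) next with next post
... | halts run′ ≤U post′ = halts (⇓seq run run′) (ℕ.+-mono-≤ ≤T ≤U) post′

slower : T ≤ U → Runs p s T Q → Runs p s U Q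
slower T≤U (halts run ≤T post) = halts run (ℕ.≤-trans ≤T T≤U) post

finally : (∀ {s} → P s → Q s) → Runs p s T P → Runs p s T Q
finally f (halts run ≤T post) = halts run ≤T (f post)

branch : ∀ {i} → (reg s i ≢ 0 → Runs p s T Q) → (reg s i ≡ 0 → Runs q s T Q) →
         Runs (ifnz i p q) s (suc T) Q
branch {s = s} {i = i} yes! no! with reg s i ℕ.≟ 0
... | yes ≡0 with no! ≡0
...   | halts run ≤T post = halts (⇓else ≡0 run) (s≤s ≤T) post
branch {s = s} {i = i} yes! no! | no ≢0 with yes! ≢0
...   | halts run ≤T post = halts (⇓then ≢0 run) (s≤s ≤T) post

-- Each round costs its body and one test; the final 1 is the failing test. With `i` in `Fin N`, the
-- decremented counter can serve as the node or edge treated in that round.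
countdown : ∀ {c N} (I : ℕ → State → Set) → (∀ {i s} → I i s → reg s c ≡ i) →
            (∀ (i : Fin N) {s} → I (suc (toℕ i)) s → Runs p s T (I (toℕ i))) →
            I N s → Runs (whilenz c p) s (N * suc T + 1) (I 0)
countdown {p} {T} {c = c} {N} I counter body = go N ℕ.≤-refl
  where
  go : ∀ i {s} → i ≤ N → I i s → Runs (whilenz c p) s (i * suc T + 1) (I 0)
  go zero    _   inv = halts (⇓exit (counter inv)) ℕ.≤-refl inv
  go (suc i) i<N inv with body (fromℕ< i<N) (subst (λ j → I (suc j) _) (sym (Fin.toℕ-fromℕ< i<N)) inv)
  ... | halts run ≤T inv′ with go i (ℕ.<⇒≤ i<N) (subst (λ j → I j _) (Fin.toℕ-fromℕ< i<N) inv′)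
  ...   | halts run′ ≤T′ inv″ = halts (⇓loop (λ eq → case trans (sym (counter inv)) eq of λ ()) run run′)
    (s≤s (ℕ.≤-trans (ℕ.+-mono-≤ ≤T ≤T′) (ℕ.≤-reflexive (sym (ℕ.+-assoc T (i * suc T) 1))))) inv″

-- `B` need not be the negation of `A`: a loop can record what it has refuted so far, and negation
-- becomes an exchange of sides.
Verdict : ℕ → Set → Set → Set
Verdict w A B = (w ≡ 1 × A) ⊎ (w ≡ 0 × B)

verdict-map : ∀ {w A A′ B B′} → (A → A′) → (B → B′) → Verdict w A B → Verdict w A′ B′
verdict-map f g = Sum.map (λ (eq , a) → eq , f a) (λ (eq , b) → eq , g b)

verdict-nonzero : ∀ {w A B} → Verdict w A B → w ≢ 0 → A
verdict-nonzero (inj₁ (_ , a))  _  = a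
verdict-nonzero (inj₂ (≡0 , _)) ≢0 = ⊥-elim (≢0 ≡0)

verdict-zero : ∀ {w A B} → Verdict w A B → w ≡ 0 → B
verdict-zero (inj₁ (≡1 , _)) ≡0 = case trans (sym ≡1) ≡0 of λ ()
verdict-zero (inj₂ (_ , b))  _  = b

-- Registers 0–2 are scratch, 3–5 belong to the reachability test; the
-- offset lets comparisons of a variable with these reduce.
var : ℕ → Reg
var i = 6 + i

var-other : ∀ f {i j} n → j ≢ i → (f [ var i ≔ n ]) (var j) ≡ f (var j)
var-other f {i} {j} n j≢i = ≔-other f {var i} {var j} n λ { refl → j≢i refl }

-- Variables bound by enclosing quantifiers sit below `b`; subprograms work at `b` and above.
Frame : ℕ → State → State → Set
Frame b s s′ = ∀ {i} → i < b → reg s′ (var i) ≡ reg s (var i)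

-- Reading the encoded graph

module Input (G : MultiDigraph) where
  open MultiDigraph G

  -- The length of the encoding: two counts and two cells per edge. Cells from here on are free for
  -- marks.
  base : ℕ
  base = #edges + #edges + 2

  Intact : (ℕ → ℕ) → Set
  Intact m = ∀ {j} → j < base → m j ≡ contents (encodeGraph G) j

  -- `h` is arbitrary because the recursion through `tabulate` composes it with `suc`; the identity
  -- is the case of interest.
  contents-pairs : ∀ {A : Set} {k} (f g : A → ℕ) (h : Fin k → A) (e : Fin k) (o : Fin 2) →
    contents (concatMap (λ e → f e ∷ g e ∷ []) (tabulate h)) (toℕ o + (toℕ e + toℕ e)) ≡
    lookup (f (h e) ∷ g (h e) ∷ []) o
  contents-pairs f g h zero    zero       = refl
  contents-pairs f g h zero    (suc zero) = refl
  contents-pairs f g h (suc e) zero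
    rewrite ℕ.+-suc (toℕ e) (toℕ e) = contents-pairs f g (h ∘ suc) e zero
  contents-pairs f g h (suc e) (suc zero)
    rewrite ℕ.+-suc (toℕ e) (toℕ e) = contents-pairs f g (h ∘ suc) e (suc zero)

  double< : ∀ (e : Fin #edges) → suc (suc (toℕ e + toℕ e)) ≤ #edges + #edges
  double< e = subst (_≤ #edges + #edges) (cong suc (ℕ.+-suc (toℕ e) (toℕ e)))
                (ℕ.+-mono-≤ (Fin.toℕ<n e) (Fin.toℕ<n e))

  module _ {m : ℕ → ℕ} (intact : Intact m) where

    read-#nodes : m 0 ≡ #nodes
    read-#nodes = intact (subst (0 <_) (ℕ.+-comm 2 (#edges + #edges)) (s≤s z≤n))

    read-#edges : m 1 ≡ #edges
    read-#edges = intact (subst (1 <_) (ℕ.+-comm 2 (#edges + #edges)) (s≤s (s≤s z≤n)))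

    read-src : ∀ {i} e → i ≡ toℕ e → m (i + i + 2) ≡ toℕ (src e)
    read-src e refl = trans (intact (ℕ.+-monoˡ-≤ 2 (ℕ.≤-trans (ℕ.n≤1+n _) (double< e))))
      (trans (cong (contents (encodeGraph G)) (ℕ.+-comm (toℕ e + toℕ e) 2))
             (contents-pairs _ _ (λ e → e) e zero))

    read-tgt : ∀ {i} e → i ≡ toℕ e → m (i + i + 2 + 1) ≡ toℕ (tgt e)
    read-tgt e refl = trans
      (intact (subst (_< base) (ℕ.+-comm 1 (toℕ e + toℕ e + 2)) (ℕ.+-monoˡ-≤ 2 (double< e))))
      (trans (cong (contents (encodeGraph G)) (trans (ℕ.+-comm (toℕ e + toℕ e + 2) 1)
                                                     (cong suc (ℕ.+-comm (toℕ e + toℕ e) 2))))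
             (contents-pairs _ _ (λ e → e) e (suc zero)))

  intact-≔ : ∀ {m a u n} → Intact m → a ≡ base + u → Intact (m [ a ≔ n ])
  intact-≔ {m} {u = u} {n} intact refl {j} j<B =
    trans (≔-other m n λ { refl → ℕ.m+n≮m base u j<B }) (intact j<B)

-- Input cell `k` holds the number of rounds: cell 0 for nodes, cell 1 for edges. `var (suc b)`
-- counts down and is read by the body as the current node or edge, while `var b` collects the
-- verdict. All rounds are run even after a success.
search : ℕ → ℕ → Program → Program
search k b body =
  set 0 k ⨾ load (var (suc b)) 0 ⨾ set (var b) 0 ⨾
  whilenz (var (suc b))
    (set 0 1 ⨾ sub (var (suc b)) (var (suc b)) 0 ⨾ body ⨾ ifnz 0 (set (var b) 1) skip) ⨾
  set 0 0 ⨾ add 0 0 (var b)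

-- Besides the body, a round takes one step for the loop test, two for the decrement and two for
-- recording. The 6 counts three steps of preparation, the failing test and two steps of copying the
-- verdict.
searchTime : ℕ → ℕ → ℕ
searchTime N T = N * (T + 5) + 6

module _ (G : MultiDigraph) where
  open Input G

  record Post (b : ℕ) (s : State) (A B : Set) (s′ : State) : Set where
    constructor post
    field
      frame   : Frame b s s′
      intact  : Intact (mem s′)
      verdict : Verdict (reg s′ 0) A B

  module _ {N k b body s} (A B : Fin N → Set) (intact₀ : Intact (mem s)) (count : mem s k ≡ N)
    (bodyRuns : ∀ i {s′} → Frame b s s′ → Intact (mem s′) → reg s′ (var (suc b)) ≡ toℕ i →
                Runs body s′ T (Post (2 + b) s′ (A i) (B i)))
    where

    private
      record I (i : ℕ) (s′ : State) : Set where
        constructor inv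
        field
          frame   : Frame b s s′
          intact  : Intact (mem s′)
          counter : reg s′ (var (suc b)) ≡ i
          -- The counter runs down, so the indices tried so far are those from `i` on.
          verdict : Verdict (reg s′ (var b)) (∃[ j ] A j) (∀ j → i ≤ toℕ j → B j)

      round : ∀ (i : Fin N) {s} → I (suc (toℕ i)) s →
        Runs (set 0 1 ⨾ sub (var (suc b)) (var (suc b)) 0 ⨾ body ⨾ ifnz 0 (set (var b) 1) skip)
          s (2 + (T + 2)) (I (toℕ i))
      round i {⟨ r , m ⟩} (inv fr int cnt ver) = step ⇓set $ step ⇓sub $
        chain (bodyRuns i frame₁ int counter₁) record-verdict
        where
        r₁ : ℕ → ℕ
        r₁ = (r [ 0 ≔ 1 ]) [ var (suc b) ≔ r (var (suc b)) ∸ 1 ]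

        counter₁ : r₁ (var (suc b)) ≡ toℕ i
        counter₁ = trans (≔-same (r [ 0 ≔ 1 ]) (var (suc b)) (r (var (suc b)) ∸ 1)) (cong (_∸ 1) cnt)

        kept : ∀ {j} → j ≢ suc b → r₁ (var j) ≡ r (var j)
        kept = var-other (r [ 0 ≔ 1 ]) (r (var (suc b)) ∸ 1)

        frame₁ : Frame b s ⟨ r₁ , m ⟩
        frame₁ j<b = trans (kept (ℕ.<⇒≢ (ℕ.m<n⇒m<1+n j<b))) (fr j<b)

        extend : B i → (∀ j → suc (toℕ i) ≤ toℕ j → B j) → ∀ j → toℕ i ≤ toℕ j → B j
        extend bi rest j i≤j with ℕ.m≤n⇒m<n∨m≡n i≤j
        ... | inj₁ i<j = rest j i<j
        ... | inj₂ i≡j = subst B (Fin.toℕ-injective i≡j) bi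

        record-verdict : ∀ {s′} → Post (2 + b) ⟨ r₁ , m ⟩ (A i) (B i) s′ →
                         Runs (ifnz 0 (set (var b) 1) skip) s′ 2 (I (toℕ i))
        record-verdict {⟨ r′ , m′ ⟩} (post fr′ int′ ver′) = branch
          (λ r′0≢0 → stop ⇓set (inv
            (λ j<b → trans (var-other r′ 1 (ℕ.<⇒≢ j<b)) (frame₂ j<b)) int′
            (trans (var-other r′ 1 ℕ.1+n≢n) counter₂)
            (inj₁ (≔-same r′ (var b) 1 , i , verdict-nonzero ver′ r′0≢0))))
          (λ r′0≡0 → stop ⇓skip (inv frame₂ int′ counter₂
            (subst (λ w → Verdict w _ _)
              (sym (trans (fr′ (ℕ.m<n⇒m<1+n (ℕ.n<1+n b))) (kept (ℕ.<⇒≢ (ℕ.n<1+n b)))))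
              (verdict-map (λ ∃a → ∃a)
                (extend (verdict-zero ver′ r′0≡0)) ver))))
          where
          frame₂ : Frame b s ⟨ r′ , m′ ⟩
          frame₂ j<b = trans (fr′ (ℕ.m<n⇒m<1+n (ℕ.m<n⇒m<1+n j<b))) (frame₁ j<b)
          counter₂ : r′ (var (suc b)) ≡ toℕ i
          counter₂ = trans (fr′ (ℕ.n<1+n (suc b))) counter₁

    search-runs : Runs (search k b body) s (searchTime N T) (Post b s (∃[ i ] A i) (∀ i → B i))
    search-runs = slower enough $ step ⇓set $ step ⇓load $ step ⇓set $
      chain (countdown I I.counter round (inv
          (λ j<b → trans (var-other r₂ 0 (ℕ.<⇒≢ j<b)) (var-other r₁ (mem s k) (ℕ.<⇒≢ (ℕ.m<n⇒m<1+n j<b))))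
          intact₀
          (trans (var-other r₂ 0 ℕ.1+n≢n) (trans (≔-same r₁ (var (suc b)) (mem s k)) count))
          (inj₂ (≔-same r₂ (var b) 0 , λ j N≤j → contradiction (Fin.toℕ<n j) (ℕ.≤⇒≯ N≤j)))))
        λ (inv fr int _ ver) → step ⇓set $ stop ⇓add
              (post fr int (verdict-map (λ a → a) (λ nb j → nb j z≤n) ver))
      where
      r₁ r₂ : ℕ → ℕ
      r₁ = reg s [ 0 ≔ k ]
      r₂ = r₁ [ var (suc b) ≔ mem s k ]
      enough : 3 + (N * suc (2 + (T + 2)) + 1 + 2) ≤ searchTime N T
      enough = ℕ.≤-reflexive (trans
        (cong (λ t → 3 + (N * t + 1 + 2)) (trans (cong (3 +_) (ℕ.+-comm T 2)) (ℕ.+-comm 5 T)))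
        (trans (cong (3 +_) (ℕ.+-assoc (N * (T + 5)) 1 2))
               (trans (ℕ.+-comm 3 _) (ℕ.+-assoc (N * (T + 5)) 3 3))))

private variable
  k : ℕ

lookup-injective : ∀ {A : Set} {xs : List A} → Unique xs →
                   ∀ i j → List.lookup xs i ≡ List.lookup xs j → i ≡ j
lookup-injective (x∉ ∷ u) zero    zero    _  = refl
lookup-injective (x∉ ∷ u) zero    (suc j) eq = ⊥-elim (All.lookup x∉ (∈-lookup j) eq)
lookup-injective (x∉ ∷ u) (suc i) zero    eq = ⊥-elim (All.lookup x∉ (∈-lookup i) (sym eq))
lookup-injective (x∉ ∷ u) (suc i) (suc j) eq = cong suc (lookup-injective u i j eq)

-- The pigeonhole principle on list positions. It bounds simple paths, and with them the number of
-- marking rounds.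
Unique⇒length≤ : ∀ {n} {xs : List (Fin n)} → Unique xs → length xs ≤ n
Unique⇒length≤ u = Fin.injective⇒≤ λ {i} {j} → lookup-injective u i j

-- Reachability by marking

-- The mark of node u is the memory cell base + u.  Forbidden nodes are
-- never skipped; instead their marks are erased again after every write.

wipe : Vec ℕ k → List (Fin k) → Program
wipe σ []       = skip
wipe σ (x ∷ xs) = set 0 0 ⨾ add 1 3 (var (lookup σ x)) ⨾ store 1 0 ⨾ wipe σ xs

-- Register 5 holds an edge index e, whose ends are in cells 2e + 2 and 2e + 3. Register 2 receives
-- the mark of the source and register 1 the address of the mark of the target.
propagate : Vec ℕ k → List (Fin k) → Program
propagate σ xs =
  set 0 2 ⨾ add 1 5 5 ⨾ add 1 1 0 ⨾ load 2 1 ⨾ add 2 3 2 ⨾ load 2 2 ⨾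
  set 0 1 ⨾ add 1 1 0 ⨾ load 1 1 ⨾ add 1 3 1 ⨾
  ifnz 2 (store 1 0) skip ⨾ wipe σ xs

-- Marks left by earlier tests are cleared first. Then each of `#nodes` rounds propagates along
-- every edge once; register 4 counts rounds, register 5 edges.
reachCode : Vec ℕ k → Fin k → Fin k → List (Fin k) → Program
reachCode σ s t xs =
  set 0 1 ⨾ load 3 0 ⨾ add 3 3 3 ⨾ set 0 2 ⨾ add 3 3 0 ⨾
  set 0 0 ⨾ load 4 0 ⨾
  whilenz 4 (set 0 1 ⨾ sub 4 4 0 ⨾ set 0 0 ⨾ add 1 3 4 ⨾ store 1 0) ⨾
  set 0 1 ⨾ add 1 3 (var (lookup σ s)) ⨾ store 1 0 ⨾
  wipe σ xs ⨾
  set 0 0 ⨾ load 4 0 ⨾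
  whilenz 4
    (set 0 1 ⨾ sub 4 4 0 ⨾ load 5 0 ⨾
     whilenz 5 (set 0 1 ⨾ sub 5 5 0 ⨾ propagate σ xs)) ⨾
  -- The invariants only know marks to be nonzero, so the answer is normalised to 1.
  add 1 3 (var (lookup σ t)) ⨾ load 0 1 ⨾ ifnz 0 (set 0 1) skip

wipeTime : List (Fin k) → ℕ
wipeTime []       = 1
wipeTime (_ ∷ xs) = 3 + wipeTime xs

reachTime : List (Fin k) → ℕ → ℕ → ℕ
reachTime xs n m = 7 + (n * 6 + 1 + (3 + (wipeTime xs + (2 +
  (n * suc (3 + (m * suc (14 + wipeTime xs) + 1)) + 1 + 4)))))

module _ (G : MultiDigraph) where
  open MultiDigraph G
  open Input G
  open Reachability G

  module _ (σ : Vec ℕ k) (ρ : Vec Node k) (s₀ : State)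
           (values : ∀ j → reg s₀ (var (lookup σ j)) ≡ toℕ (lookup ρ j)) where

    record Context (s : State) : Set where
      constructor context
      field
        saved   : ∀ i → reg s (var i) ≡ reg s₀ (var i)
        at-base : reg s 3 ≡ base
        intact  : Intact (mem s)

    record Same (s s′ : State) : Set where
      constructor same
      field
        outer : reg s′ 4 ≡ reg s 4
        inner : reg s′ 5 ≡ reg s 5

    Marked : (ℕ → ℕ) → Node → Set
    Marked m u = m (base + toℕ u) ≢ 0

    module _ {m : ℕ → ℕ} {a n : ℕ} {u : Node} (a≡ : a ≡ base + toℕ u) where

      mark-same : (m [ a ≔ n ]) (base + toℕ u) ≡ n
      mark-same = subst (λ b → (m [ b ≔ n ]) (base + toℕ u) ≡ n) (sym a≡) (≔-same m (base + toℕ u) n)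

      mark-other : ∀ {v} → v ≢ u → (m [ a ≔ n ]) (base + toℕ v) ≡ m (base + toℕ v)
      mark-other v≢u = ≔-other m n λ eq →
        v≢u (Fin.toℕ-injective (ℕ.+-cancelˡ-≡ base _ _ (trans eq a≡)))

    node-address : ∀ {s} → Context s → ∀ x → reg s 3 + reg s (var (lookup σ x)) ≡ base + toℕ (lookup ρ x)
    node-address (context saved at-base _) x = cong₂ _+_ at-base (trans (saved _) (values x))

    module _ (xs : List (Fin k)) where
      forbidden : List Node
      forbidden = List.map (lookup ρ) xs

      record Wiped (m m′ : ℕ → ℕ) : Set where
        constructor wiped
        field
          only : ∀ {u} → Marked m′ u → u ∉ forbidden × Marked m u
          kept : ∀ {u} → u ∉ forbidden → Marked m u → Marked m′ u

    wipe-runs : ∀ xs {s} → Context s →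
      Runs (wipe σ xs) s (wipeTime xs) (λ s′ → Context s′ × Same s s′ × Wiped xs (mem s) (mem s′))
    wipe-runs []       ctx = stop ⇓skip (ctx , same refl refl , wiped (λ mk → (λ ()) , mk) (λ _ mk → mk))
    wipe-runs (x ∷ xs) {⟨ r , m ⟩} ctx@(context saved at-base intact) =
      step ⇓set $ step ⇓add $ step ⇓store $
      finally
        (λ (ctx′ , same o i , wiped only kept) → ctx′ , same o i , wiped
          (λ mk → let u∉ , mk₁ = only mk in
            (λ { (here eq) → wiped-≢ mk₁ eq ; (there u∈) → u∉ u∈ }) ,
            λ eq → mk₁ (trans (mark-other {m} address (wiped-≢ mk₁)) eq))
          (λ u∉ mk → kept (u∉ ∘ there) λ eq →
            mk (trans (sym (mark-other {m} address (u∉ ∘ here))) eq)))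
        (wipe-runs xs (context saved at-base (intact-≔ intact address)))
      where
      address : r 3 + r (var (lookup σ x)) ≡ base + toℕ (lookup ρ x)
      address = node-address ctx x
      m₁ : ℕ → ℕ
      m₁ = m [ r 3 + r (var (lookup σ x)) ≔ 0 ]
      wiped-≢ : ∀ {u} → Marked m₁ u → u ≢ lookup ρ x
      wiped-≢ mk₁ refl = mk₁ (mark-same {m} address)

    module _ (xs : List (Fin k)) where

      private X = forbidden xs

      record Propagated (e : Edge) (m m′ : ℕ → ℕ) : Set where
        constructor propagated
        field
          only : ∀ {u} → Marked m′ u → u ∉ X × (Marked m u ⊎ (Marked m (src e) × u ≡ tgt e))
          kept : ∀ {u} → u ∉ X → Marked m u → Marked m′ u
          new  : Marked m (src e) → tgt e ∉ X → Marked m′ (tgt e)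

      propagate-runs : ∀ e {s} → Context s → reg s 5 ≡ toℕ e →
        Runs (propagate σ xs) s (12 + wipeTime xs)
          (λ s′ → Context s′ × Same s s′ × Propagated e (mem s) (mem s′))
      propagate-runs e {⟨ r , m ⟩} ctx@(context saved at-base intact) r5≡e =
        step ⇓set $ step ⇓add $ step ⇓add $ step ⇓load $ step ⇓add $ step ⇓load $
        step ⇓set $ step ⇓add $ step ⇓load $ step ⇓add $
        chain {P = Visited} (branch visit leave)
          λ (ctx₁ , same o₁ i₁ , only₁ , kept₁ , new₁) → finally
            (λ (ctx₂ , same o₂ i₂ , wiped only₂ kept₂) →
              ctx₂ , same (trans o₂ o₁) (trans i₂ i₁) , propagated
                (λ mk → let u∉X , mk₁ = only₂ mk in u∉X , only₁ mk₁)
                (λ u∉X mk → kept₂ u∉X (kept₁ mk))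
                (λ mk ∉X → kept₂ ∉X (new₁ mk)))
            (wipe-runs xs ctx₁)
        where
        src-mark : m (r 3 + m (r 5 + r 5 + 2)) ≡ m (base + toℕ (src e))
        src-mark = cong m (cong₂ _+_ at-base (read-src intact e r5≡e))
        tgt-address : r 3 + m (r 5 + r 5 + 2 + 1) ≡ base + toℕ (tgt e)
        tgt-address = cong₂ _+_ at-base (read-tgt intact e r5≡e)
        m₁ : ℕ → ℕ
        m₁ = m [ r 3 + m (r 5 + r 5 + 2 + 1) ≔ 1 ]
        fresh : Marked m (src e) → ∀ {u} → Marked m₁ u → Marked m u ⊎ (Marked m (src e) × u ≡ tgt e)
        fresh mk {u} mk₁ with u ≟ tgt e
        ... | yes u≡tgt = inj₂ (mk , u≡tgt)
        ... | no  u≢tgt = inj₁ λ eq → mk₁ (trans (mark-other {m} tgt-address u≢tgt) eq)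
        Visited : State → Set
        Visited s′ = Context s′ × Same ⟨ r , m ⟩ s′ ×
          (∀ {u} → Marked (mem s′) u → Marked m u ⊎ (Marked m (src e) × u ≡ tgt e)) ×
          (∀ {u} → Marked m u → Marked (mem s′) u) × (Marked m (src e) → Marked (mem s′) (tgt e))
        preserve : ∀ u → Marked m u → Marked m₁ u
        preserve u mk with u ≟ tgt e
        ... | yes refl  = subst (_≢ 0) (sym (mark-same {m} tgt-address)) λ ()
        ... | no  u≢tgt = λ eq → mk (trans (sym (mark-other {m} tgt-address u≢tgt)) eq)
        r₁ : ℕ → ℕ
        r₁ = r [ 0 ≔ 2 ] [ 1 ≔ r 5 + r 5 ] [ 1 ≔ r 5 + r 5 + 2 ] [ 2 ≔ m (r 5 + r 5 + 2) ]
             [ 2 ≔ r 3 + m (r 5 + r 5 + 2) ] [ 2 ≔ m (r 3 + m (r 5 + r 5 + 2)) ] [ 0 ≔ 1 ]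
             [ 1 ≔ r 5 + r 5 + 2 + 1 ] [ 1 ≔ m (r 5 + r 5 + 2 + 1) ] [ 1 ≔ r 3 + m (r 5 + r 5 + 2 + 1) ]
        visit : m (r 3 + m (r 5 + r 5 + 2)) ≢ 0 → Runs (store 1 0) ⟨ r₁ , m ⟩ 1 Visited
        visit marked = stop ⇓store
          ( context saved at-base (intact-≔ intact tgt-address) , same refl refl
          , (λ mk → fresh (λ eq → marked (trans src-mark eq)) mk)
          , (λ {u} mk → preserve u mk)
          , λ _ → subst (_≢ 0) (sym (mark-same {m} tgt-address)) λ () )
        leave : m (r 3 + m (r 5 + r 5 + 2)) ≡ 0 → Runs skip ⟨ r₁ , m ⟩ 1 Visited
        leave unmarked = stop ⇓skip
          ( context saved at-base intact , same refl refl
          , inj₁ , (λ mk → mk) , λ mk → ⊥-elim (mk (trans (sym src-mark) unmarked)) )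

      module _ (s t : Fin k) where

        private
          x = lookup ρ s
          y = lookup ρ t

        Sound : (ℕ → ℕ) → Set
        Sound m = ∀ {u} → Marked m u → Reach X x u

        -- The number of edges still to be traversed is at most the number of
        -- rounds left, because simple paths have fewer edges than there are nodes.
        Near : ℕ → (ℕ → ℕ) → Set
        Near i m = ∀ {u} → Reach X x u →
          ∃[ w ] (Marked m w × (Σ[ π ∈ Star (Step X) w u ] length (origins π) ≤ i))

        avoids-end : ∀ {u} → Reach X x u → u ∉ X
        avoids-end (x∉X , π) = All.lookup (avoids x∉X π) (last∈ π)

        record Clearing (i : ℕ) (s : State) : Set where
          constructor clearing
          field
            ctx     : Context s
            counter : reg s 4 ≡ i
            cleared : ∀ (u : Node) → i ≤ toℕ u → mem s (base + toℕ u) ≡ 0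

        record Round (i : ℕ) (s : State) : Set where
          constructor round
          field
            ctx     : Context s
            counter : reg s 4 ≡ i
            sound   : Sound (mem s)
            near    : Near i (mem s)

        -- `M` is the memory at the start of the round. Nodes marked during the pass may propagate
        -- too, but only those marked in `M` are promised to.
        record Pass (i : ℕ) (M : ℕ → ℕ) (e : ℕ) (s : State) : Set where
          constructor pass
          field
            ctx     : Context s
            counter : reg s 4 ≡ i
            edge    : reg s 5 ≡ e
            sound   : Sound (mem s)
            kept    : ∀ {u} → Marked M u → Marked (mem s) u
            done    : ∀ f → e ≤ toℕ f → Marked M (src f) → tgt f ∉ X → Marked (mem s) (tgt f)

        clear-step : ∀ (u : Node) {s} → Clearing (suc (toℕ u)) s →
          Runs (set 0 1 ⨾ sub 4 4 0 ⨾ set 0 0 ⨾ add 1 3 4 ⨾ store 1 0) s 5 (Clearing (toℕ u))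
        clear-step u {⟨ r , m ⟩} (clearing (context saved at-base intact) counter cleared) =
          step ⇓set $ step ⇓sub $ step ⇓set $ step ⇓add $ stop ⇓store
            (clearing (context saved at-base (intact-≔ intact address)) (cong (_∸ 1) counter) cleared′)
          where
          address : r 3 + (r 4 ∸ 1) ≡ base + toℕ u
          address = cong₂ _+_ at-base (cong (_∸ 1) counter)
          cleared′ : ∀ (v : Node) → toℕ u ≤ toℕ v → (m [ r 3 + (r 4 ∸ 1) ≔ 0 ]) (base + toℕ v) ≡ 0
          cleared′ v u≤v with v ≟ u
          ... | yes refl = mark-same {m} address
          ... | no v≢u   = trans (mark-other {m} address v≢u)
                  (cleared v (ℕ.≤∧≢⇒< u≤v λ eq → v≢u (sym (Fin.toℕ-injective eq))))

        pass-step : ∀ {i M} (e : Edge) {s} → Sound M → Pass i M (suc (toℕ e)) s →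
          Runs (set 0 1 ⨾ sub 5 5 0 ⨾ propagate σ xs) s (14 + wipeTime xs) (Pass i M (toℕ e))
        pass-step {i} {M} e soundM
          (pass (context saved at-base intact) counter edge sound kept done) =
          step ⇓set $ step ⇓sub $ finally conclude
            (propagate-runs e (context saved at-base intact) (cong (_∸ 1) edge))
          where
          conclude : ∀ {s′} → _ → Pass i M (toℕ e) s′
          conclude {s′} (ctx′ , same o i , propagated only′ kept′ new′) = pass ctx′ (trans o counter)
            (trans i (cong (_∸ 1) edge))
            (λ mk → case only′ mk of λ
              { (_ , inj₁ mk₁) → sound mk₁
              ; (u∉X , inj₂ (mk₁ , refl)) →
                  let (x∉X , π) = sound mk₁ in x∉X , π ◅◅ ((e , refl , refl) , u∉X) ◅ ε })
            -- A node marked in `M` is reachable, hence outside `X`, so the wipe spares it.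
            (λ mk → kept′ (avoids-end (soundM mk)) (kept mk))
            λ f e≤f mk ∉X → case ℕ.m≤n⇒m<n∨m≡n e≤f of λ
              { (inj₁ e<f) → kept′ ∉X (done f e<f mk ∉X)
              ; (inj₂ e≡f) → case Fin.toℕ-injective e≡f of λ { refl → new′ (kept mk) ∉X } }

        round-step : ∀ {s} (i : Node) → Round (suc (toℕ i)) s →
          Runs (set 0 1 ⨾ sub 4 4 0 ⨾ load 5 0 ⨾ whilenz 5 (set 0 1 ⨾ sub 5 5 0 ⨾ propagate σ xs)) s
            (3 + (#edges * suc (14 + wipeTime xs) + 1)) (Round (toℕ i))
        round-step {⟨ r , m ⟩} i (round (context saved at-base intact) counter sound near) =
          step ⇓set $ step ⇓sub $ step ⇓load $ finally conclude $
          countdown (Pass (toℕ i) m) Pass.edge (λ e → pass-step e sound)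
            (pass (context saved at-base intact) (cong (_∸ 1) counter) (read-#edges intact)
              sound (λ mk → mk) (λ f ≤f → contradiction (Fin.toℕ<n f) (ℕ.≤⇒≯ ≤f)))
          where
          conclude : ∀ {s′} → Pass (toℕ i) m 0 s′ → Round (toℕ i) s′
          conclude {s′} (pass ctx counter _ sound′ kept done) = round ctx counter sound′ near′
            where
            near′ : Near (toℕ i) (mem s′)
            near′ r with near r
            ... | w , mk , ε , _ = w , kept mk , ε , z≤n
            -- The pass has traversed the first edge `f` of the path, so its head is marked and one
            -- edge less remains.
            ... | w , mk , ((f , refl , refl) , ∉X) ◅ π , s≤s ≤i = tgt f , done f z≤n mk ∉X , π , ≤i

        record Reached (s : State) : Set where
          constructor reached
          field
            saved   : ∀ i → reg s (var i) ≡ reg s₀ (var i)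
            intact  : Intact (mem s)
            verdict : Verdict (reg s 0) (Reach X x y) (¬ Reach X x y)

        short-origins : ∀ {u} (π : Star (Step X) x u) → Unique (trail π) → length (origins π) ≤ #nodes
        short-origins π u = Unique⇒length≤ (proj₁ (Unique-++⁻ (origins π) u))

        record Seeded (s : State) : Set where
          constructor seeded
          field
            ctx   : Context s
            sound : Sound (mem s)
            near  : Near #nodes (mem s)

        seed-runs : ∀ {s′} → Clearing 0 s′ → Runs (wipe σ xs)
          ⟨ reg s′ [ 0 ≔ 1 ] [ 1 ≔ reg s′ 3 + reg s′ (var (lookup σ s)) ]
          , mem s′ [ reg s′ 3 + reg s′ (var (lookup σ s)) ≔ 1 ] ⟩ (wipeTime xs) Seeded
        seed-runs {⟨ r , m ⟩} (clearing ctx@(context saved at-base intact) _ cleared) =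
          finally conclude (wipe-runs xs (context saved at-base (intact-≔ intact address)))
          where
          address : r 3 + r (var (lookup σ s)) ≡ base + toℕ x
          address = node-address ctx s
          conclude : ∀ {s′} → _ → Seeded s′
          conclude {s′} (ctx′ , _ , wiped only kept) = seeded ctx′ sound near
            where
            sound : Sound (mem s′)
            sound {u} mk with only mk
            ... | u∉X , mk₁ with u ≟ x
            ...   | yes refl = u∉X , ε
            ...   | no u≢x   = ⊥-elim (mk₁ (trans (mark-other {m} address u≢x) (cleared u z≤n)))
            near : Near #nodes (mem s′)
            near (x∉X , π) with simplify π
            ... | ϖ , simple , _ = x , kept x∉X (subst (_≢ 0) (sym (mark-same {m} address)) λ ()) ,
                                   ϖ , short-origins ϖ simple

        answer-runs : ∀ {s′} → Round 0 s′ →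
          Runs (add 1 3 (var (lookup σ t)) ⨾ load 0 1 ⨾ ifnz 0 (set 0 1) skip) s′ 4 Reached
        answer-runs {⟨ r , m ⟩} (round ctx@(context saved at-base intact) _ sound near) =
          step ⇓add $ step ⇓load $ branch
            (λ ≢0 → stop ⇓set (reached saved intact
              (inj₁ (refl , sound (subst (λ a → m a ≢ 0) address ≢0)))))
            -- With no round left the path given by `near` is empty, so a reachable node would be
            -- marked.
            (λ ≡0 → stop ⇓skip (reached saved intact (inj₂ (≡0 , λ r → case near r of λ
              { (w , mk , ε , _) → mk (subst (λ a → m a ≡ 0) address ≡0) ; (_ , _ , (_ ◅ _) , ()) }))))
          where
          address : r 3 + r (var (lookup σ t)) ≡ base + toℕ y
          address = node-address ctx t

        reach-runs : Intact (mem s₀) → Runs (reachCode σ s t xs) s₀ (reachTime xs #nodes #edges) Reached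
        reach-runs intact₀ =
          step ⇓set $ step ⇓load $ step ⇓add $ step ⇓set $ step ⇓add $ step ⇓set $ step ⇓load $
          chain (countdown Clearing Clearing.counter clear-step
            (clearing (context (λ _ → refl) (cong (λ e → e + e + 2) (read-#edges intact₀)) intact₀)
              (read-#nodes intact₀) (λ u ≤u → contradiction (Fin.toℕ<n u) (ℕ.≤⇒≯ ≤u)))) λ c →
          step ⇓set $ step ⇓add $ step ⇓store $
          chain (seed-runs c) λ (seeded (context saved at-base intact) sound near) →
          step ⇓set $ step ⇓load $
          chain (countdown Round Round.counter (λ i → round-step i)
            (round (context saved at-base intact) (read-#nodes intact) sound near)) answer-runs

-- First-order formulas over reachability

data Formula (k : ℕ) : Set where
  _≐_ _⟶_  : Fin k → Fin k → Formula k
  reach    : Fin k → Fin k → List (Fin k) → Formula k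
  neg      : Formula k → Formula k
  _and_ _or_ : Formula k → Formula k → Formula k
  ex all   : Formula (suc k) → Formula k

infix  6 _≐_ _⟶_
infixr 5 _and_
infixr 4 _or_

module _ (G : MultiDigraph) where
  open MultiDigraph G
  open Reachability G using (Adjacent; Reach)

  Holds : Formula k → Vec Node k → Set
  Holds (x ≐ y)        ρ = lookup ρ x ≡ lookup ρ y
  Holds (x ⟶ y)        ρ = Adjacent (lookup ρ x) (lookup ρ y)
  Holds (reach s t xs) ρ = Reach (List.map (lookup ρ) xs) (lookup ρ s) (lookup ρ t)
  Holds (neg φ)        ρ = ¬ Holds φ ρ
  Holds (φ and ψ)      ρ = Holds φ ρ × Holds ψ ρ
  Holds (φ or ψ)       ρ = Holds φ ρ ⊎ Holds ψ ρ
  Holds (ex φ)         ρ = ∃[ v ] Holds φ (v ∷ ρ)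
  Holds (all φ)        ρ = ∀ v → Holds φ (v ∷ ρ)

flip : Program
flip = ifnz 0 (set 0 0) (set 0 1)

fetchEnds : ℕ → Program
fetchEnds e =
  set 0 2 ⨾ add 1 (var e) (var e) ⨾ add 1 1 0 ⨾ load 2 1 ⨾ set 0 1 ⨾ add 1 1 0 ⨾ load 1 1

-- The machine has no equality test, but two numbers agree exactly when both truncated differences
-- vanish. All four differences are added and compared with zero.
compareEnds : ℕ → ℕ → Program
compareEnds u v =
  sub 0 2 (var u) ⨾ sub 2 (var u) 2 ⨾ add 2 0 2 ⨾
  sub 0 1 (var v) ⨾ sub 1 (var v) 1 ⨾ add 1 0 1 ⨾
  add 0 2 1 ⨾ flip

-- `σ` assigns to each variable the index of its register, and `b` is the first free index. The
-- counter of a search is the bound variable itself. A universal quantifier is a failed search for a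
-- counterexample.
compile : Formula k → Vec ℕ k → ℕ → Program
compile (x ≐ y)        σ b = sub 0 (var (lookup σ x)) (var (lookup σ y)) ⨾
                             sub 1 (var (lookup σ y)) (var (lookup σ x)) ⨾ add 0 0 1 ⨾ flip
compile (x ⟶ y)        σ b = search 1 b (fetchEnds (suc b) ⨾ compareEnds (lookup σ x) (lookup σ y))
compile (reach s t xs) σ b = reachCode σ s t xs
compile (neg φ)        σ b = compile φ σ b ⨾ flip
compile (φ and ψ)      σ b = compile φ σ b ⨾ ifnz 0 (compile ψ σ b) skip
compile (φ or ψ)       σ b = compile φ σ b ⨾ ifnz 0 skip (compile ψ σ b)
compile (ex φ)         σ b = search 0 b (compile φ (suc b ∷ σ) (2 + b))
compile (all φ)        σ b = search 0 b (compile φ (suc b ∷ σ) (2 + b) ⨾ flip) ⨾ flip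

-- Here n bounds both the number of nodes and the number of edges.
cost : Formula k → ℕ → ℕ
cost (x ≐ y)        n = 5
cost (x ⟶ y)        n = searchTime n 16
cost (reach s t xs) n = reachTime xs n n
cost (neg φ)        n = cost φ n + 2
cost (φ and ψ)      n = cost φ n + suc (suc (cost ψ n))
cost (φ or ψ)       n = cost φ n + suc (suc (cost ψ n))
cost (ex φ)         n = searchTime n (cost φ n)
cost (all φ)        n = searchTime n (cost φ n + 2) + 2

searchTime-mono : ∀ {m n T} → m ≤ n → searchTime m T ≤ searchTime n T
searchTime-mono {T = T} m≤n = ℕ.+-monoˡ-≤ 6 (ℕ.*-monoˡ-≤ (T + 5) m≤n)

reachTime-mono : ∀ (xs : List (Fin k)) {n n′ m m′} → n ≤ n′ → m ≤ m′ →
                 reachTime xs n m ≤ reachTime xs n′ m′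
reachTime-mono xs n≤ m≤ = ℕ.+-monoʳ-≤ 7 $ ℕ.+-mono-≤ (ℕ.+-monoˡ-≤ 1 (ℕ.*-monoˡ-≤ 6 n≤)) $
  ℕ.+-monoʳ-≤ 3 $ ℕ.+-monoʳ-≤ (wipeTime xs) $ ℕ.+-monoʳ-≤ 2 $ ℕ.+-monoˡ-≤ 4 $ ℕ.+-monoˡ-≤ 1 $
  ℕ.*-mono-≤ n≤ (s≤s (ℕ.+-monoʳ-≤ 3 (ℕ.+-monoˡ-≤ 1 (ℕ.*-monoˡ-≤ (suc (14 + wipeTime xs)) m≤))))

distance : ℕ → ℕ → ℕ
distance m n = (m ∸ n) + (n ∸ m)

distance≡0 : ∀ m n → distance m n ≡ 0 → m ≡ n
distance≡0 m n eq = ℕ.≤-antisym (ℕ.m∸n≡0⇒m≤n (ℕ.m+n≡0⇒m≡0 (m ∸ n) eq))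
                                (ℕ.m∸n≡0⇒m≤n (ℕ.m+n≡0⇒n≡0 (m ∸ n) eq))

distance-self : ∀ n → distance n n ≡ 0
distance-self n rewrite ℕ.n∸n≡0 n = refl

-- Correctness of compiled formulas

module Correctness (G : MultiDigraph) where
  open MultiDigraph G
  open Input G
  open Reachability G using (Adjacent; Reach)

  record Good (b : ℕ) (σ : Vec ℕ k) (ρ : Vec Node k) (s : State) : Set where
    constructor good
    field
      intact : Intact (mem s)
      below  : ∀ j → lookup σ j < b
      values : ∀ j → reg s (var (lookup σ j)) ≡ toℕ (lookup ρ j)

  flip-runs : ∀ {A B b s s′} → Post G b s A B s′ → Runs flip s′ 2 (Post G b s B A)
  flip-runs (post fr int (inj₁ (≡1 , a))) = branch
    (λ _ → stop ⇓set (post fr int (inj₂ (refl , a))))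
    (λ ≡0 → case trans (sym ≡1) ≡0 of λ ())
  flip-runs (post fr int (inj₂ (≡0 , b))) = branch
    (λ ≢0 → ⊥-elim (≢0 ≡0))
    (λ _ → stop ⇓set (post fr int (inj₁ (refl , b))))

  zero-test : ∀ {P b s r m w} → Frame b s ⟨ r , m ⟩ → Intact m → r 0 ≡ w → (w ≡ 0 → P) → (P → w ≡ 0) →
              Runs flip ⟨ r , m ⟩ 2 (Post G b s P (¬ P))
  zero-test fr int refl f g = branch
    (λ ≢0 → stop ⇓set (post fr int (inj₂ (refl , ≢0 ∘ g))))
    (λ ≡0 → stop ⇓set (post fr int (inj₁ (refl , f ≡0))))

  record Fetched (f : Edge) (s s′ : State) : Set where
    constructor fetched
    field
      saved  : ∀ i → reg s′ (var i) ≡ reg s (var i)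
      intact : Intact (mem s′)
      at-src : reg s′ 2 ≡ toℕ (src f)
      at-tgt : reg s′ 1 ≡ toℕ (tgt f)

  fetchEnds-runs : ∀ {e} f {s} → Intact (mem s) → reg s (var e) ≡ toℕ f →
                   Runs (fetchEnds e) s 7 (Fetched f s)
  fetchEnds-runs f {⟨ r , m ⟩} intact e≡f =
    step ⇓set $ step ⇓add $ step ⇓add $ step ⇓load $ step ⇓set $ step ⇓add $ stop ⇓load
    (fetched (λ _ → refl) intact (read-src intact f e≡f) (read-tgt intact f e≡f))

  compareEnds-runs : ∀ {b u v} {f : Edge} {x y : Node} {s s′} → Fetched f s s′ →
    reg s (var u) ≡ toℕ x → reg s (var v) ≡ toℕ y →
    Runs (compareEnds u v) s′ 9 (Post G b s (src f ≡ x × tgt f ≡ y) (¬ (src f ≡ x × tgt f ≡ y)))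
  compareEnds-runs {f = f} {x} {y} {s′ = ⟨ r , m ⟩} (fetched saved intact at-src at-tgt) u≡x v≡y =
    step ⇓sub $ step ⇓sub $ step ⇓add $ step ⇓sub $ step ⇓sub $ step ⇓add $ step ⇓add $
    zero-test (λ {i} _ → saved i) intact
      (cong₂ _+_ (cong₂ distance at-src (trans (saved _) u≡x))
                 (cong₂ distance at-tgt (trans (saved _) v≡y)))
      (λ eq → Fin.toℕ-injective (distance≡0 (toℕ (src f)) (toℕ x) (ℕ.m+n≡0⇒m≡0 _ eq)) ,
              Fin.toℕ-injective (distance≡0 (toℕ (tgt f)) (toℕ y)
                (ℕ.m+n≡0⇒n≡0 (distance (toℕ (src f)) (toℕ x)) eq)))
      λ { (refl , refl) → cong₂ _+_ (distance-self (toℕ x)) (distance-self (toℕ y)) }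

  below-extend : ∀ {b} {σ : Vec ℕ k} → (∀ j → lookup σ j < b) → ∀ j → lookup (suc b ∷ σ) j < 2 + b
  below-extend {b = b} below zero    = ℕ.n<1+n (suc b)
  below-extend         below (suc j) = ℕ.m<n⇒m<1+n (ℕ.m<n⇒m<1+n (below j))

  good-extend : ∀ {b} {σ : Vec ℕ k} {ρ s s′ v} → Good b σ ρ s → Frame b s s′ → Intact (mem s′) →
                reg s′ (var (suc b)) ≡ toℕ v → Good (2 + b) (suc b ∷ σ) (v ∷ ρ) s′
  good-extend (good _ below values) fr int eq = good int (below-extend below) λ where
    zero    → eq
    (suc j) → trans (fr (below j)) (values j)

  good-after : ∀ {b} {σ : Vec ℕ k} {ρ s s′ A B} → Good b σ ρ s → Post G b s A B s′ → Good b σ ρ s′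
  good-after (good _ below values) (post fr int _) = good int below λ j → trans (fr (below j)) (values j)

  after-post : ∀ {b s s′ s″ A B A′ B′ C D} → Post G b s A B s′ → (A′ → C) → (B′ → D) →
               Post G b s′ A′ B′ s″ → Post G b s C D s″
  after-post (post fr _ _) f g (post fr′ int ver) =
    post (λ i<b → trans (fr′ i<b) (fr i<b)) int (verdict-map f g ver)

  post-map : ∀ {b s s′ A B A′ B′} → (A → A′) → (B → B′) → Post G b s A B s′ → Post G b s A′ B′ s′
  post-map f g (post fr int ver) = post fr int (verdict-map f g ver)

  size : ℕ
  size = sizeGraph G

  compile-runs : ∀ (φ : Formula k) {σ b ρ s} → Good b σ ρ s →
    Runs (compile φ σ b) s (cost φ size) (Post G b s (Holds G φ ρ) (¬ Holds G φ ρ))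
  compile-runs (x ≐ y) {σ} {b} {ρ} {⟨ r , m ⟩} (good int below values) =
    step ⇓sub $ step ⇓sub $ step ⇓add $ zero-test (λ _ → refl) int
      (cong₂ distance (values x) (values y))
      (λ eq → Fin.toℕ-injective (distance≡0 _ _ eq))
      (λ eq → subst (λ v → distance (toℕ (lookup ρ x)) (toℕ v) ≡ 0) eq (distance-self (toℕ (lookup ρ x))))
  compile-runs (x ⟶ y) {σ} {b} {ρ} {s} (good int below values) =
    slower (searchTime-mono {T = 16} (ℕ.m≤n+m #edges #nodes)) $
    finally (post-map (λ a → a) (λ none (e , eq) → none e eq)) $
    search-runs G (λ e → src e ≡ lookup ρ x × tgt e ≡ lookup ρ y)
      (λ e → ¬ (src e ≡ lookup ρ x × tgt e ≡ lookup ρ y))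
      int (read-#edges int) λ e fr int′ eq → chain (fetchEnds-runs e int′ eq) λ fetch →
        compareEnds-runs fetch (trans (fr (below x)) (values x)) (trans (fr (below y)) (values y))
  compile-runs (reach s t xs) {σ} {b} {ρ} (good int below values) =
    slower (reachTime-mono xs (ℕ.m≤m+n #nodes #edges) (ℕ.m≤n+m #edges #nodes)) $
    finally (λ (reached saved int′ ver) → post (λ {i} _ → saved i) int′ ver) $
    reach-runs G σ ρ _ values xs s t int
  compile-runs (neg φ) gd = chain (compile-runs φ gd) λ p →
    finally (post-map (λ a → a) (λ h ¬h → ¬h h)) (flip-runs p)
  compile-runs (φ and ψ) gd = chain (compile-runs φ gd) λ p → branch
    -- The branches share the bound `suc (cost ψ size)`, whose extra step leaves room for the `skip`
    -- of the other branch.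
    (λ ≢0 → slower (ℕ.n≤1+n _) $ finally
      (after-post p (λ ψ → verdict-nonzero (Post.verdict p) ≢0 , ψ) (λ ¬ψ → ¬ψ ∘ proj₂))
      (compile-runs ψ (good-after gd p)))
    (λ ≡0 → slower (s≤s z≤n) $ stop ⇓skip $ let post fr int ver = p in
      post fr int (inj₂ (≡0 , verdict-zero ver ≡0 ∘ proj₁)))
  compile-runs (φ or ψ) gd = chain (compile-runs φ gd) λ p → branch
    (λ ≢0 → slower (s≤s z≤n) $ stop ⇓skip $
      post-map inj₁ (λ ¬φ → ⊥-elim (¬φ (verdict-nonzero (Post.verdict p) ≢0))) p)
    (λ ≡0 → slower (ℕ.n≤1+n _) $ finally
      (after-post p inj₂ λ ¬ψ → [ verdict-zero (Post.verdict p) ≡0 , ¬ψ ]′)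
      (compile-runs ψ (good-after gd p)))
  compile-runs (ex φ) {σ} {b} {ρ} gd@(good int _ _) =
    slower (searchTime-mono (ℕ.m≤m+n #nodes #edges)) $
    finally (post-map (λ a → a) (λ none (v , h) → none v h)) $
    search-runs G (λ v → Holds G φ (v ∷ ρ)) (λ v → ¬ Holds G φ (v ∷ ρ)) int (read-#nodes int)
      λ v fr int′ eq → compile-runs φ (good-extend gd fr int′ eq)
  compile-runs (all φ) {σ} {b} {ρ} gd@(good int _ _) =
    chain (slower (searchTime-mono (ℕ.m≤m+n #nodes #edges)) $
      -- As `flip` has exchanged the sides, an unsuccessful search carries proofs of `φ` itself and
      -- not of its double negation.
      search-runs G (λ v → ¬ Holds G φ (v ∷ ρ)) (λ v → Holds G φ (v ∷ ρ)) int (read-#nodes int)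
        λ v fr int′ eq → chain (compile-runs φ (good-extend gd fr int′ eq)) flip-runs)
      λ p → finally (post-map (λ a → a) (λ (v , ¬h) h → ¬h (h v))) (flip-runs p)

-- Polynomial time bounds

Polynomial : (ℕ → ℕ) → Set
Polynomial f = ∃[ k ] (∀ n → f n ≤ (2 + n) ^ k)

poly-const : ∀ c → Polynomial (λ _ → c)
poly-const c = c , λ n → ℕ.≤-trans (lemma c) (ℕ.^-monoˡ-≤ c (ℕ.m≤m+n 2 n))
  where
  lemma : ∀ c → c ≤ 2 ^ c
  lemma zero    = z≤n
  lemma (suc c) = ℕ.+-mono-≤ (ℕ.m^n>0 2 c) (ℕ.≤-trans (lemma c) (ℕ.m≤m+n _ 0))

poly-id : Polynomial (λ n → n)
poly-id = 1 , λ n → ℕ.≤-trans (ℕ.m≤n+m n 2) (ℕ.≤-reflexive (sym (ℕ.^-identityʳ (2 + n))))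

poly-* : ∀ {f g} → Polynomial f → Polynomial g → Polynomial (λ n → f n * g n)
poly-* (j , f≤) (k , g≤) = j + k , λ n →
  ℕ.≤-trans (ℕ.*-mono-≤ (f≤ n) (g≤ n)) (ℕ.≤-reflexive (sym (ℕ.^-distribˡ-+-* (2 + n) j k)))

-- The base is at least 2, so one more factor absorbs the doubling; this is why the bounds need no
-- coefficients.
poly-+ : ∀ {f g} → Polynomial f → Polynomial g → Polynomial (λ n → f n + g n)
poly-+ {f} {g} (j , f≤) (k , g≤) = suc (j + k) , λ n → let M = 2 + n in begin
  f n + g n                     ≤⟨ ℕ.+-mono-≤ (f≤ n) (g≤ n) ⟩
  M ^ j + M ^ k                 ≤⟨ ℕ.+-mono-≤ (ℕ.^-monoʳ-≤ M (ℕ.m≤m+n j k))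
                                               (ℕ.^-monoʳ-≤ M (ℕ.m≤n+m k j)) ⟩
  M ^ (j + k) + M ^ (j + k)     ≡⟨ cong (M ^ (j + k) +_) (sym (ℕ.+-identityʳ _)) ⟩
  2 * M ^ (j + k)               ≤⟨ ℕ.*-monoˡ-≤ (M ^ (j + k)) (ℕ.m≤m+n 2 n) ⟩
  M * M ^ (j + k)               ∎
  where open ℕ.≤-Reasoning

poly-search : ∀ {f} → Polynomial f → Polynomial (λ n → searchTime n (f n))
poly-search p = poly-+ (poly-* poly-id (poly-+ p (poly-const 5))) (poly-const 6)

poly-cost : ∀ (φ : Formula k) → Polynomial (cost φ)
poly-cost (x ≐ y)        = poly-const 5
poly-cost (x ⟶ y)        = poly-search (poly-const 16)
poly-cost (reach s t xs) =
  poly-+ (poly-const 7) $ poly-+ (poly-+ (poly-* poly-id (poly-const 6)) (poly-const 1)) $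
  poly-+ (poly-const 3) $ poly-+ (poly-const (wipeTime xs)) $ poly-+ (poly-const 2) $
  poly-+ (poly-+ (poly-* poly-id (poly-+ (poly-const 4)
    (poly-+ (poly-* poly-id (poly-const (15 + wipeTime xs))) (poly-const 1)))) (poly-const 1)) (poly-const 4)
poly-cost (neg φ)        = poly-+ (poly-cost φ) (poly-const 2)
poly-cost (φ and ψ)      = poly-+ (poly-cost φ) (poly-+ (poly-const 2) (poly-cost ψ))
poly-cost (φ or ψ)       = poly-+ (poly-cost φ) (poly-+ (poly-const 2) (poly-cost ψ))
poly-cost (ex φ)         = poly-search (poly-cost φ)
poly-cost (all φ)        = poly-+ (poly-search (poly-+ (poly-cost φ) (poly-const 2))) (poly-const 2)

^-distribʳ-* : ∀ k m n → (m * n) ^ k ≡ m ^ k * n ^ k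
^-distribʳ-* zero    m n = refl
^-distribʳ-* (suc k) m n = trans (cong (m * n *_) (^-distribʳ-* k m n))
                                 (ℕ.[m*n]*[o*p]≡[m*o]*[n*p] m n (m ^ k) (n ^ k))

-- For positive n, 2 + n is at most 3n; the added constant covers n = 0.
^-bound : ∀ k n → (2 + n) ^ k ≤ 3 ^ k * n ^ k + 3 ^ k
^-bound k zero    = ℕ.≤-trans (ℕ.^-monoˡ-≤ k (ℕ.n≤1+n 2)) (ℕ.m≤n+m (3 ^ k) (3 ^ k * 0 ^ k))
^-bound k (suc n) = begin
  (3 + n) ^ k                 ≤⟨ ℕ.^-monoˡ-≤ k (ℕ.+-monoʳ-≤ 3 (ℕ.m≤n*m n 3)) ⟩
  (3 + 3 * n) ^ k             ≡⟨ cong (_^ k) (sym (ℕ.*-suc 3 n)) ⟩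
  (3 * suc n) ^ k             ≡⟨ ^-distribʳ-* k 3 (suc n) ⟩
  3 ^ k * suc n ^ k           ≤⟨ ℕ.m≤m+n _ (3 ^ k) ⟩
  3 ^ k * suc n ^ k + 3 ^ k   ∎
  where open ℕ.≤-Reasoning

formula-decidable : (φ : Formula 0) → PolyTimeDecidable encodeGraph sizeGraph (λ G → Holds G φ [])
formula-decidable φ with poly-cost φ
... | degree , cost≤ = compile φ [] 0 , 3 ^ degree , degree , decide
  where
  decide : ∀ G → ∃[ t ] ∃[ s ] (compile φ [] 0 ⊢ initial (encodeGraph G) ⇓[ t ] s
    × t ≤ 3 ^ degree * sizeGraph G ^ degree + 3 ^ degree
    × Verdict (reg s 0) (Holds G φ []) (¬ Holds G φ []))
  decide G with Correctness.compile-runs G φ {s = initial (encodeGraph G)}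
                  (Correctness.good {σ = []} {ρ = []} (λ _ → refl) (λ ()) (λ ()))
  ... | halts run ≤T (post _ _ ver) = _ , _ , run ,
        ℕ.≤-trans ≤T (ℕ.≤-trans (cost≤ (sizeGraph G)) (^-bound degree (sizeGraph G))) , ver

decidable-resp-⇔ : ∀ {A : Set} {encode : A → List ℕ} {size P Q} → (∀ x → P x → Q x) → (∀ x → Q x → P x) →
                   PolyTimeDecidable encode size P → PolyTimeDecidable encode size Q
decidable-resp-⇔ P⇒Q Q⇒P (p , c , k , decide) = p , c , k , λ x →
  let t , s , run , t≤ , ver = decide x in t , s , run , t≤ , verdict-map (P⇒Q x) (_∘ Q⇒P x) ver

-- Free variables, innermost first: x, v, q, p, d, a.
criterion : Formula 0
criterion = ex $ ex $ ex $ ex $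
  neg (# 3 ≐ # 2) and # 3 ⟶ # 1 and # 3 ⟶ # 0 and
  all (ex (# 0 ⟶ # 4 and reach (# 3) (# 0) (# 5 ∷ # 4 ∷ []) and
    (reach (# 3) (# 0) (# 5 ∷ # 4 ∷ # 1 ∷ []) or reach (# 2) (# 0) (# 5 ∷ # 4 ∷ # 1 ∷ []))))

corollary5p4 : PolyTimeDecidable encodeGraph sizeGraph (λ G → HomeomorphicSubgraph Wheatstone G)
corollary5p4 = decidable-resp-⇔ {encode = encodeGraph} {size = sizeGraph}
  Reachability.criterion⇒subdivision Reachability.subdivision⇒criterion
  (formula-decidable criterion)
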